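{- Let $\mathbf{x}^{(i)}=(\mathbf{x}^{(i)}_1,\mathbf{x}^{(i)}_2,\dots)$, $i\ge1$, be sequences of countably many variables, and let $n$ be a positive integer. (a) For every positive integer $m$, $$\sum_{\lambda:\ \ell(\lambda)\le n}s_\lambda(\mathbf{x}^{(1)})\cdots s_\lambda(\mathbf{x}^{(2m)})=\mathrm{Det}^{[2m]}\Big(\sum_{k\ge0}h_{k-i_1}(\mathbf{x}^{(1)})h_{k-i_2}(\mathbf{x}^{(2)})\cdots h_{k-i_{2m}}(\mathbf{x}^{(2m)})\Big)_{1\le i_1,\dots,i_{2m}\le n}.$$ (b) For every odd positive integer $m$, $$\sum_{\lambda:\ \ell(\lambda)\le 2n}s_\lambda(\mathbf{x}^{(1)})\cdots s_\lambda(\mathbf{x}^{(m)})=\mathrm{Pf}^{[2m]}\Big(\sum_{k,l\ge0}\prod_{s=1}^m\det\begin{pmatrix}h_{k+l+1-i_{2s-1}}(\mathbf{x}^{(s)})&h_{l-i_{2s-1}}(\mathbf{x}^{(s)})\\ h_{k+l+1-i_{2s}}(\mathbf{x}^{(s)})&h_{l-i_{2s}}(\mathbf{x}^{(s)})\end{pmatrix}\Big)_{1\le i_1,\dots,i_{2m}\le 2n}.$$ Both identities hold as identities of formal power series.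
   Context: $h_k$ is the complete symmetric function $h_k(\mathbf{x})=\sum_{k_1+k_2+\cdots=k,\ k_i\ge0}\mathbf{x}_1^{k_1}\mathbf{x}_2^{k_2}\cdots$ for $k\ge0$ and $h_k=0$ for $k<0$; $s_\lambda$ is the Schur function in countably many variables, $s_\lambda=\det(h_{\lambda_i-i+j})$. Hyperdeterminant: $\mathrm{Det}^{[2m]}(A):=\frac{1}{n!}\sum_{\sigma_1,\dots,\sigma_{2m}\in\mathfrak{S}_n}\mathrm{sgn}(\sigma_1)\cdots\mathrm{sgn}(\sigma_{2m})\prod_{i=1}^nA(\sigma_1(i),\dots,\sigma_{2m}(i))$. Hyperpfaffian of an array $B$ indexed by $\{1,\dots,2n\}^{2m}$ that changes sign when $i_{2s-1},i_{2s}$ are interchanged (each $s$): with $\mathfrak{E}_{2n}=\{\sigma\in\mathfrak{S}_{2n}:\sigma(2i-1)<\sigma(2i)\}$, $\mathrm{Pf}^{[2m]}(B):=\frac{1}{n!}\sum_{\sigma_1,\dots,\sigma_m\in\mathfrak{E}_{2n}}\prod_s\mathrm{sgn}(\sigma_s)\prod_{i=1}^nB(\sigma_1(2i-1),\sigma_1(2i),\dots,\sigma_m(2i-1),\sigma_m(2i))$.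
   Formalization: In part (b) a factor (-1)^n is placed in front of the hyperpfaffian; without it the identity fails for odd n (for n = m = 1 the constant terms are 1 on the left and -1 on the right), and for even n nothing changes. -}

module Defs where

open import Data.Bool.Base using (if_then_else_; _∧_)
open import Data.Fin.Base as Fin using (Fin; toℕ; combine)
open import Data.Fin.Patterns using (0F; 1F)
open import Data.Fin.Properties as Fin using ()
open import Data.Integer.Base as ℤ using (ℤ; +_; -[1+_])
open import Data.List.Base as List using (List; []; _∷_; _∷ʳ_; allFin; upTo; filter; cartesianProduct; cartesianProductWith)
open import Data.List.Membership.Propositional using (_∈_)
import Data.List.Properties as List
open import Data.List.Relation.Unary.All using (All)
open import Data.List.Relation.Unary.Linked using (Linked)
open import Data.List.Relation.Unary.Unique.Propositional using (Unique)
import Data.List.Relation.Unary.Unique.DecPropositional as DecUnique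
open import Data.Nat.Base as ℕ using (ℕ; zero; suc; _≥_; _!; _≡ᵇ_)
open import Data.Nat.ListAction using (sum)
open import Data.Nat.Properties as ℕ using (_!≢0)
open import Data.Product.Base as Product using (Σ-syntax; ∃-syntax; _×_; _,_; proj₁; proj₂)
open import Data.Rational.Base as ℚ using (ℚ; 0ℚ; 1ℚ; _/_)
import Data.Rational.Properties as ℚ
open import Data.Vec.Base as Vec using (Vec; []; _∷_; lookup; replicate; toList)
open import Algebra.Definitions.RawSemiring ℚ.+-*-rawSemiring using (_^_)
open import Function.Base using (_∘_)
open import Relation.Binary.PropositionalEquality
open import Relation.Nullary.Decidable using (_×-dec_)

private
  variable
    A B C : Set
    M : ℕ

-- The j-th entry of a monomial lists the exponents of the j-th variable
-- of each of the M alphabets; all exponents past the end are 0.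
Monomial : ℕ → Set
Monomial M = List (Vec ℕ M)

-- Lists differing only in trailing zero entries denote the same
-- monomial, and padded makes coeff respect this identification.
record Series (M : ℕ) : Set where
  constructor mkSeries
  field
    coeff  : Monomial M → ℚ
    padded : ∀ μ → coeff (μ ∷ʳ replicate M 0) ≡ coeff μ

open Series public

-- split μ lists the pairs (α , β) of monomials with α β = μ, once each.
splitℕ : ℕ → List (ℕ × ℕ)
splitℕ a = List.map (λ i → i , a ℕ.∸ i) (upTo (suc a))

splitᵛ : Vec ℕ M → List (Vec ℕ M × Vec ℕ M)
splitᵛ []      = ([] , []) ∷ []
splitᵛ (a ∷ e) = cartesianProductWith (Product.zip _∷_ _∷_) (splitℕ a) (splitᵛ e)

split : Monomial M → List (Monomial M × Monomial M)
split []      = ([] , []) ∷ []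
split (e ∷ μ) = cartesianProductWith (Product.zip _∷_ _∷_) (splitᵛ e) (split μ)

pad₂ : Monomial M × Monomial M → Monomial M × Monomial M
pad₂ = Product.map (_∷ʳ replicate _ 0) (_∷ʳ replicate _ 0)

splitᵛ-0 : ∀ M → splitᵛ (replicate M 0) ≡ (replicate M 0 , replicate M 0) ∷ []
splitᵛ-0 zero    = refl
splitᵛ-0 (suc M) rewrite splitᵛ-0 M = refl

cartesianProductWith-map : (f : A → B → B) (g : B → B) →
  (∀ x y → f x (g y) ≡ g (f x y)) → ∀ xs ys →
  cartesianProductWith f xs (List.map g ys) ≡ List.map g (cartesianProductWith f xs ys)
cartesianProductWith-map f g comm []       ys = refl
cartesianProductWith-map f g comm (x ∷ xs) ys = begin
  List.map (f x) (List.map g ys) List.++ cartesianProductWith f xs (List.map g ys)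
    ≡⟨ cong₂ List._++_
         (trans (sym (List.map-∘ ys)) (trans (List.map-cong (comm x) ys) (List.map-∘ ys)))
         (cartesianProductWith-map f g comm xs ys) ⟩
  List.map g (List.map (f x) ys) List.++ List.map g (cartesianProductWith f xs ys)
    ≡⟨ List.map-++ g (List.map (f x) ys) _ ⟨
  List.map g (List.map (f x) ys List.++ cartesianProductWith f xs ys) ∎
  where open ≡-Reasoning

split-pad : (μ : Monomial M) → split (μ ∷ʳ replicate M 0) ≡ List.map pad₂ (split μ)
split-pad {M} []      rewrite splitᵛ-0 M = refl
split-pad {M} (e ∷ μ) = trans
  (cong (cartesianProductWith _ (splitᵛ e)) (split-pad μ))
  (cartesianProductWith-map _ pad₂ (λ _ _ → refl) (splitᵛ e) (split μ))

sum-pad : (f : Vec ℕ M → ℕ) → f (replicate M 0) ≡ 0 → ∀ μ →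
  sum (List.map f (μ ∷ʳ replicate M 0)) ≡ sum (List.map f μ)
sum-pad f f0 []      = cong (ℕ._+ 0) f0
sum-pad f f0 (e ∷ μ) = cong (f e ℕ.+_) (sum-pad f f0 μ)

lookup-0 : ∀ M (s : Fin M) → lookup (replicate M 0) s ≡ 0
lookup-0 (suc M) Fin.zero    = refl
lookup-0 (suc M) (Fin.suc s) = lookup-0 M s

sum-0 : ∀ M → Vec.sum (replicate M 0) ≡ 0
sum-0 zero    = refl
sum-0 (suc M) = sum-0 M

sumℚ : List ℚ → ℚ
sumℚ = List.foldr ℚ._+_ 0ℚ

infixl 6 _+_
infixl 7 _*_
infixr 7 _•_

0ˢ 1ˢ : Series M
0ˢ = mkSeries (λ _ → 0ℚ) (λ _ → refl)
1ˢ {M} = mkSeries one one-padded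
  where
  one : Monomial M → ℚ
  one μ = if sum (List.map Vec.sum μ) ≡ᵇ 0 then 1ℚ else 0ℚ
  abstract
    one-padded : ∀ μ → one (μ ∷ʳ replicate M 0) ≡ one μ
    one-padded μ = cong (λ d → if d ≡ᵇ 0 then 1ℚ else 0ℚ) (sum-pad Vec.sum (sum-0 M) μ)

_+_ : Series M → Series M → Series M
_+_ {M} f g = mkSeries plus plus-padded
  where
  plus : Monomial M → ℚ
  plus μ = coeff f μ ℚ.+ coeff g μ
  abstract
    plus-padded : ∀ μ → plus (μ ∷ʳ replicate M 0) ≡ plus μ
    plus-padded μ = cong₂ ℚ._+_ (padded f μ) (padded g μ)

_*_ : Series M → Series M → Series M
_*_ {M} f g = mkSeries times times-padded
  where
  term : Monomial M × Monomial M → ℚ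
  term (α , β) = coeff f α ℚ.* coeff g β
  times : Monomial M → ℚ
  times μ = sumℚ (List.map term (split μ))
  abstract
    times-padded : ∀ μ → times (μ ∷ʳ replicate M 0) ≡ times μ
    times-padded μ = cong sumℚ (begin
      List.map term (split (μ ∷ʳ replicate M 0))  ≡⟨ cong (List.map term) (split-pad μ) ⟩
      List.map term (List.map pad₂ (split μ))     ≡⟨ List.map-∘ (split μ) ⟨
      List.map (term ∘ pad₂) (split μ)
        ≡⟨ List.map-cong (λ (α , β) → cong₂ ℚ._*_ (padded f α) (padded g β)) (split μ) ⟩
      List.map term (split μ)                     ∎)
      where open ≡-Reasoning

_•_ : ℚ → Series M → Series M
_•_ {M} c f = mkSeries scaled scaled-padded
  where
  scaled : Monomial M → ℚ
  scaled μ = c ℚ.* coeff f μ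
  abstract
    scaled-padded : ∀ μ → scaled (μ ∷ʳ replicate M 0) ≡ scaled μ
    scaled-padded μ = cong (c ℚ.*_) (padded f μ)

∑ ∏ : List A → (A → Series M) → Series M
∑ xs f = List.foldr _+_ 0ˢ (List.map f xs)
∏ xs f = List.foldr _*_ 1ˢ (List.map f xs)

-- Σ_{i : I} f i converges formally to S: for each monomial only finitely
-- many f i contribute, and their contributions add up to its coefficient
-- in S.
HasSum : {I : Set} → (I → Series M) → Series M → Set
HasSum f S = ∀ μ → ∃[ is ] (Unique is ×
  (∀ i → coeff (f i) μ ≢ 0ℚ → i ∈ is) ×
  coeff S μ ≡ sumℚ (List.map (λ i → coeff (f i) μ) is))

-- h s k is h_k of the s-th alphabet.  A monomial occurs in it, with
-- coefficient 1, exactly when its degree in the s-th alphabet and its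
-- total degree both equal k.
h : Fin M → ℤ → Series M
h {M} s (+ k) = mkSeries complete complete-padded
  where
  degree total : Monomial M → ℕ
  degree μ = sum (List.map (λ e → lookup e s) μ)
  total  μ = sum (List.map Vec.sum μ)
  occurs : ℕ → ℕ → ℚ
  occurs d t = if (d ≡ᵇ k) ∧ (t ≡ᵇ k) then 1ℚ else 0ℚ
  complete : Monomial M → ℚ
  complete μ = occurs (degree μ) (total μ)
  abstract
    complete-padded : ∀ μ → complete (μ ∷ʳ replicate M 0) ≡ complete μ
    complete-padded μ = cong₂ occurs (sum-pad (λ e → lookup e s) (lookup-0 M s) μ)
                                     (sum-pad Vec.sum (sum-0 M) μ)
h s -[1+ _ ] = 0ˢ

words : (k : ℕ) → List A → List (Vec A k)
words zero    xs = [] ∷ []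
words (suc k) xs = cartesianProductWith _∷_ xs (words k xs)

-- Permutations are given in one-line notation.
𝔖 : (n : ℕ) → List (Vec (Fin n) n)
𝔖 n = filter (λ σ → DecUnique.unique? Fin._≟_ (toList σ)) (words n (allFin n))

inversions : ∀ {n} → Vec (Fin n) n → ℕ
inversions {n} σ = List.length (filter
  (λ (i , j) → (i Fin.<? j) ×-dec (lookup σ j Fin.<? lookup σ i))
  (cartesianProduct (allFin n) (allFin n)))

sgn : ∀ {n} → Vec (Fin n) n → ℚ
sgn σ = (ℚ.- 1ℚ) ^ inversions σ

sgns : ∀ {n k} → Vec (Vec (Fin n) n) k → ℚ
sgns = Vec.foldr′ (λ σ c → sgn σ ℚ.* c) 1ℚ

-- With {1,…,2n} rendered as Fin (n * 2), the i-th consecutive pair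
-- (2i-1, 2i) becomes (odd i, even i).
odd even : ∀ {n} → Fin n → Fin (n ℕ.* 2)
odd  i = combine i 0F
even i = combine i 1F

𝔈 : (n : ℕ) → List (Vec (Fin (n ℕ.* 2)) (n ℕ.* 2))
𝔈 n = filter (λ σ → Fin.all? {n = n} λ i → lookup σ (odd i) Fin.<? lookup σ (even i)) (𝔖 (n ℕ.* 2))

1/_! : ℕ → ℚ
1/ n ! = (+ 1 / n !) {{n !≢0}}

det : ∀ {n} → (Fin n → Fin n → Series M) → Series M
det {n = n} a = ∑ (𝔖 n) λ σ → sgn σ • ∏ (allFin n) λ i → a i (lookup σ i)

matrix₂ : (a b c d : A) → Fin 2 → Fin 2 → A
matrix₂ a b c d i j = lookup (lookup ((a ∷ b ∷ []) ∷ (c ∷ d ∷ []) ∷ []) i) j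

Det : (m n : ℕ) → (Vec (Fin n) (2 ℕ.* m) → Series M) → Series M
Det m n a = 1/ n ! • ∑ (words (2 ℕ.* m) (𝔖 n)) λ σs →
  sgns σs • ∏ (allFin n) λ i → a (Vec.map (λ σ → lookup σ i) σs)

-- Only meaningful for arrays b that change sign when the entries at
-- positions odd s and even s of the index are interchanged.
Pf : (m n : ℕ) → (Vec (Fin (n ℕ.* 2)) (m ℕ.* 2) → Series M) → Series M
Pf m n b = 1/ n ! • ∑ (words m (𝔈 n)) λ σs →
  sgns σs • ∏ (allFin n) λ i →
    b (Vec.concat (Vec.map (λ σ → lookup σ (odd i) ∷ lookup σ (even i) ∷ []) σs))

record Partition : Set where
  constructor mkPartition
  field
    parts      : List ℕ
    positive   : All (0 ℕ.<_) parts
    decreasing : Linked _≥_ parts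

open Partition public

ℓ : Partition → ℕ
ℓ p = List.length (parts p)

Partition≤ : ℕ → Set
Partition≤ n = Σ[ p ∈ Partition ] ℓ p ℕ.≤ n

-- s_λ of the s-th alphabet.  The shifts by one in -i + j cancel, so the
-- 0-based indices can be used directly.
schur : Partition → Fin M → Series M
schur p s = det λ (i j : Fin (ℓ p)) →
  h s (+ List.lookup (parts p) i ℤ.- + toℕ i ℤ.+ + toℕ j)

-- Indices count from 0 in Fin and from 1 in the formulas.
pos : ∀ {n} → Fin n → ℤ
pos i = + suc (toℕ i)

-- The k-th, respectively (k , l)-th, summand of the array entry at i.
termDet : (m n : ℕ) → Vec (Fin n) (2 ℕ.* m) → ℕ → Series (2 ℕ.* m)
termDet m n i k = ∏ (allFin (2 ℕ.* m)) λ s → h s (+ k ℤ.- pos (lookup i s))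

termPf : (m n : ℕ) → Vec (Fin (n ℕ.* 2)) (m ℕ.* 2) → ℕ × ℕ → Series m
termPf m n i (k , l) = ∏ (allFin m) λ s →
  let i₁ = pos (lookup i (odd s))
      i₂ = pos (lookup i (even s))
  in det (matrix₂ (h s (+ (k ℕ.+ l ℕ.+ 1) ℤ.- i₁)) (h s (+ l ℤ.- i₁))
                  (h s (+ (k ℕ.+ l ℕ.+ 1) ℤ.- i₂)) (h s (+ l ℤ.- i₂)))

module Submission where

-- Expanding the products of array entries turns the right-hand sides into sums
-- over words k of products of the determinants det (h_{kᵢ - j}), one for each
-- alphabet.  These alternate in k.  If their number is even, the product is
-- symmetric and vanishes on words with a repeated letter, so the sum is n! times
-- the sum over strictly decreasing k.  If it is odd, the product alternates: a
-- Laplace expansion turns the sums over 𝔈 into full determinants, and summing an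
-- alternating function over all words of n decreasing pairs again gives n! times
-- the sum over strictly decreasing words of length 2n (the Pfaffian of the array
-- of ones is 1).  Writing kᵢ = λᵢ + n + 1 - i, reversal of the columns
-- gives s_λ.  Computing modulo terms of degree > D makes all sums finite.

open import Algebra.Bundles using (CommutativeMonoid; CommutativeRing)
import Algebra.Properties.Semiring.Exp
import Algebra.Properties.Semiring.Mult
import Algebra.Solver.Ring.NaturalCoefficients.Default as SemiringSolver
open import Data.Bool.Base using (true; false; if_then_else_; _∧_)
import Data.Bool.Base as Bool
import Data.Bool.Properties as Bool
open import Data.Fin.Base as Fin using (Fin; toℕ; fromℕ; inject₁; opposite)
open import Data.Fin.Patterns using (0F; 1F)
import Data.Fin.Properties as Fin
open import Data.Integer.Base as ℤ using (ℤ; +_; -[1+_])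
import Data.Integer.Properties as ℤ
import Data.Integer.Tactic.RingSolver as ℤ-solver
open import Data.List.Base as List
  using ( List; []; _∷_; _++_; allFin; applyDownFrom; applyUpTo; cartesianProduct
        ; cartesianProductWith; filter; length; upTo)
import Data.List.Properties as List
open import Data.List.Membership.Propositional using (_∈_)
open import Data.List.Membership.Propositional.Properties
  using (∈-++⁺ˡ; ∈-++⁺ʳ; ∈-++⁻; ∈-map⁺; ∈-map⁻)
open import Data.List.Relation.Unary.All as All using (All; []; _∷_)
import Data.List.Relation.Unary.All.Properties as All
open import Data.List.Relation.Unary.AllPairs using ([]; _∷_)
open import Data.List.Relation.Unary.Any using (here; there)
open import Data.List.Relation.Unary.Linked as Linked using (Linked; [-]; _∷_)
open import Data.List.Relation.Unary.Unique.Propositional using (Unique)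
import Data.List.Relation.Unary.Unique.Propositional.Properties as Unique
open import Data.Nat.Base as ℕ using (ℕ; zero; suc; _!; _≥_; _≡ᵇ_)
open import Data.Nat.Divisibility using (_∤_; ∣m∣n⇒∣m+n; ∣-refl; _∣0)
open import Data.Nat.ListAction using (sum)
import Data.Nat.Properties as ℕ
open import Data.Product.Base as Product using (Σ-syntax; _×_; _,_; proj₁; proj₂)
open import Data.Rational.Base as ℚ using (ℚ; 0ℚ; 1ℚ; ½)
import Data.Rational.Properties as ℚ
import Data.Rational.Unnormalised.Base as ℚᵘ
import Data.Rational.Unnormalised.Properties as ℚᵘ
open import Data.Sum.Base using (_⊎_; inj₁; inj₂)
open import Data.Unit.Base using (⊤; tt)
open import Data.Vec.Base as Vec using (Vec; []; _∷_; lookup; replicate; toList)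
import Data.Vec.Membership.Propositional as Vec
import Data.Vec.Properties as Vec
open import Data.Vec.Relation.Unary.Any using (here; there)
open import Function.Base using (_∘_)
open import Level using (0ℓ)
open import Relation.Binary.Definitions using (tri<; tri≈; tri>)
import Relation.Binary.PropositionalEquality as ≡
open ≡ using (_≡_; _≢_; cong; cong₂; subst)
open import Relation.Nullary using (¬_; yes; no; contradiction; does)
open import Relation.Nullary.Decidable using (decidable-stable)
open import Relation.Unary using (Pred; Decidable)
open import Defs
  using ( words; 𝔖; 𝔈; inversions; pos; odd; even
        ; mkPartition; parts; positive; Partition≤)

-- The factor (-1)^n in front of the hyperpfaffian is a reversal sign. The letters kᵢ decrease while
-- the columns j increase, so det (h_{kᵢ - j}) of order N is (-1)^(N(N-1)/2) s_λ. An even number of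
-- alphabets squares this sign away; an odd number leaves one copy, which for N = 2n is (-1)^n. For
-- n = m = 1 the array entry at (1, 2) is the sum of h_{k+l} h_{l-2} - h_{k+l-1} h_{l-1}; its terms
-- with l ≥ 1 are -s_λ for λ = (k+l-1, l-1), and those with l = 0 are zero.
--
-- Permutations are never composed or inverted. The sign is extended by zero to all words, so that
-- sums over `𝔖` become unrestricted, and symmetry or alternation is tested on adjacent
-- transpositions only. Both properties survive fixing the first letter, which makes induction on
-- the length of words possible. In exchange, vanishing on repeated letters has to be derived from x
-- = -x, whence the hypothesis `halve`.

private
  variable
    A B C I : Set
    m n N M : ℕ

-- Finite sums and products

module Folds (𝕄 : CommutativeMonoid 0ℓ 0ℓ) where
  open CommutativeMonoid 𝕄
  open import Relation.Binary.Reasoning.Setoid setoid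
  open import Algebra.Properties.CommutativeSemigroup commutativeSemigroup using (interchange; x∙yz≈y∙xz)

  fold : List A → (A → Carrier) → Carrier
  fold xs f = List.foldr _∙_ ε (List.map f xs)

  fold-cong : ∀ (xs : List A) {f g} → (∀ x → f x ≈ g x) → fold xs f ≈ fold xs g
  fold-cong []       f≈g = refl
  fold-cong (x ∷ xs) f≈g = ∙-cong (f≈g x) (fold-cong xs f≈g)

  fold-ε : ∀ (xs : List A) {f} → (∀ x → f x ≈ ε) → fold xs f ≈ ε
  fold-ε []       f≈ε = refl
  fold-ε (x ∷ xs) f≈ε = trans (∙-cong (f≈ε x) (fold-ε xs f≈ε)) (identityˡ ε)

  fold-++ : ∀ (xs ys : List A) f → fold (xs ++ ys) f ≈ fold xs f ∙ fold ys f
  fold-++ []       ys f = sym (identityˡ _)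
  fold-++ (x ∷ xs) ys f = trans (∙-congˡ (fold-++ xs ys f)) (sym (assoc _ _ _))

  fold-map : ∀ (g : A → B) xs f → fold (List.map g xs) f ≡ fold xs (f ∘ g)
  fold-map g xs f = ≡.cong (List.foldr _∙_ ε) (≡.sym (List.map-∘ xs))

  fold-∙ : ∀ (xs : List A) f g → fold xs (λ x → f x ∙ g x) ≈ fold xs f ∙ fold xs g
  fold-∙ []       f g = sym (identityˡ _)
  fold-∙ (x ∷ xs) f g = trans (∙-congˡ (fold-∙ xs f g)) (interchange _ _ _ _)

  fold-swap : ∀ (xs : List A) (ys : List B) (f : A → B → Carrier) →
    fold xs (λ x → fold ys (f x)) ≈ fold ys (λ y → fold xs (λ x → f x y))
  fold-swap []       ys f = sym (fold-ε ys λ _ → refl)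
  fold-swap (x ∷ xs) ys f = trans (∙-congˡ (fold-swap xs ys f)) (sym (fold-∙ ys _ _))

  fold-product : ∀ (k : A → B → C) xs ys f →
    fold (cartesianProductWith k xs ys) f ≈ fold xs (λ x → fold ys (λ y → f (k x y)))
  fold-product k []       ys f = refl
  fold-product k (x ∷ xs) ys f = trans (fold-++ (List.map (k x) ys) _ f)
    (∙-cong (reflexive (fold-map (k x) ys f)) (fold-product k xs ys f))

  fold-suc : ∀ n f → fold (allFin (suc n)) f ≡ f Fin.zero ∙ fold (allFin n) (f ∘ Fin.suc)
  fold-suc n f = ≡.cong (λ ys → f Fin.zero ∙ List.foldr _∙_ ε ys)
    (≡.trans (List.map-tabulate Fin.suc f) (≡.sym (List.map-tabulate (λ i → i) (f ∘ Fin.suc))))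

  fold-last : ∀ n f → fold (allFin (suc n)) f ≈ f (fromℕ n) ∙ fold (allFin n) (f ∘ inject₁)
  fold-last zero    f = refl
  fold-last (suc n) f = begin
    fold (allFin (suc (suc n))) f
      ≡⟨ fold-suc (suc n) f ⟩
    f Fin.zero ∙ fold (allFin (suc n)) (f ∘ Fin.suc)
      ≈⟨ ∙-congˡ (fold-last n (f ∘ Fin.suc)) ⟩
    f Fin.zero ∙ (f (fromℕ (suc n)) ∙ fold (allFin n) (f ∘ inject₁ ∘ Fin.suc))
      ≈⟨ x∙yz≈y∙xz _ _ _ ⟩
    f (fromℕ (suc n)) ∙ (f Fin.zero ∙ fold (allFin n) (f ∘ inject₁ ∘ Fin.suc))
      ≡⟨ ≡.cong (f (fromℕ (suc n)) ∙_) (fold-suc n (f ∘ inject₁)) ⟨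
    f (fromℕ (suc n)) ∙ fold (allFin (suc n)) (f ∘ inject₁) ∎

  fold-opposite : ∀ n f → fold (allFin n) (f ∘ opposite) ≈ fold (allFin n) f
  fold-opposite zero    f = refl
  fold-opposite (suc n) f = begin
    fold (allFin (suc n)) (f ∘ opposite)
      ≡⟨ fold-suc n (f ∘ opposite) ⟩
    f (fromℕ n) ∙ fold (allFin n) (f ∘ inject₁ ∘ opposite)
      ≈⟨ ∙-congˡ (fold-opposite n (f ∘ inject₁)) ⟩
    f (fromℕ n) ∙ fold (allFin n) (f ∘ inject₁)
      ≈⟨ fold-last n f ⟨
    fold (allFin (suc n)) f ∎

-- Adjacent transpositions suffice because they generate all permutations of positions. Each
-- constructor leaves the tail or the head letter untouched, as inductions on words require.
data Swap {A : Set} : Vec A n → Vec A n → Set where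
  here  : ∀ {x y} {w : Vec A n} → Swap (x ∷ y ∷ w) (y ∷ x ∷ w)
  there : ∀ {x} {v w : Vec A n} → Swap v w → Swap (x ∷ v) (x ∷ w)

-- Subwords of length `n`, in the order of the list. On the decreasing list `down N` they are the
-- strictly decreasing words.
comb : (n : ℕ) → List A → List (Vec A n)
comb zero    xs       = [] ∷ []
comb (suc n) []       = []
comb (suc n) (x ∷ xs) = List.map (x ∷_) (comb n xs) ++ comb (suc n) xs

pairs : List A → List (A × A)
pairs []       = []
pairs (x ∷ xs) = List.map (x ,_) xs ++ pairs xs

flatten : Vec (A × A) n → Vec A (n ℕ.* 2)
flatten []            = []
flatten ((x , y) ∷ w) = x ∷ y ∷ flatten w

module RingSums (R : CommutativeRing 0ℓ 0ℓ) where
  open CommutativeRing R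
  open import Relation.Binary.Reasoning.Setoid setoid
  open import Algebra.Properties.Ring ring using (-‿distribˡ-*)
  module Sum = Folds +-commutativeMonoid
  module Prod = Folds *-commutativeMonoid
  open Sum using () renaming (fold to ∑)

  neg≈-1* : ∀ x → - x ≈ - 1# * x
  neg≈-1* x = trans (-‿cong (sym (*-identityˡ x))) (-‿distribˡ-* 1# x)

  ∑-distribˡ : ∀ c (xs : List A) f → ∑ xs (λ x → c * f x) ≈ c * ∑ xs f
  ∑-distribˡ c []       f = sym (zeroʳ c)
  ∑-distribˡ c (x ∷ xs) f = trans (+-congˡ (∑-distribˡ c xs f)) (sym (distribˡ c _ _))

  ∑-distribʳ : ∀ c (xs : List A) f → ∑ xs (λ x → f x * c) ≈ ∑ xs f * c
  ∑-distribʳ c xs f = trans (Sum.fold-cong xs λ x → *-comm (f x) c)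
    (trans (∑-distribˡ c xs f) (*-comm c _))

  ∑-neg : ∀ (xs : List A) f → ∑ xs (λ x → - f x) ≈ - ∑ xs f
  ∑-neg xs f = begin
    ∑ xs (λ x → - f x)        ≈⟨ Sum.fold-cong xs (λ x → neg≈-1* (f x)) ⟩
    ∑ xs (λ x → - 1# * f x)   ≈⟨ ∑-distribˡ (- 1#) xs f ⟩
    - 1# * ∑ xs f             ≈⟨ neg≈-1* _ ⟨
    - ∑ xs f                  ∎

-- Two uses: for constant `g` a letter is repeated; for `g = (x ,_)` two pairs share the component
-- `x`. Only the first two positions are inspected, since symmetry can bring any two letters there.
data Clash {A I : Set} (g : I → A) : Vec A n → Set where
  clash : ∀ {i j} {w : Vec A n} → Clash g (g i ∷ g j ∷ w)

-- Partitions and subscripts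

module Shapes where
  open ≡ using (refl; sym; trans)

  -- The sequence λᵢ + n - i, 0 ≤ i < n, for λ padded with zeros.
  strict : (n : ℕ) → List ℕ → Vec ℕ n
  strict zero    xs       = []
  strict (suc n) []       = suc n ∷ strict n []
  strict (suc n) (x ∷ xs) = suc (n ℕ.+ x) ∷ strict n xs

  -- One more zero part raises every λᵢ + n - i by one and contributes a last entry 1. This drives
  -- the induction in `D-strict`.
  strict-suc : ∀ n xs → length xs ℕ.≤ n → strict (suc n) xs ≡ Vec.map suc (strict n xs) Vec.∷ʳ 1
  strict-suc zero    []       _           = ≡.refl
  strict-suc (suc n) []       _           = ≡.cong (suc (suc n) ∷_) (strict-suc n [] ℕ.z≤n)
  strict-suc (suc n) (x ∷ xs) (ℕ.s≤s len) = ≡.cong (suc (suc n ℕ.+ x) ∷_) (strict-suc n xs len)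

  lookup-strict : ∀ xs (i : Fin (length xs)) →
    lookup (strict (length xs) xs) i ℕ.+ toℕ i ≡ length xs ℕ.+ List.lookup xs i
  lookup-strict (x ∷ xs) Fin.zero    = ℕ.+-identityʳ _
  lookup-strict (x ∷ xs) (Fin.suc i) = ≡.trans (ℕ.+-suc _ (toℕ i)) (≡.cong suc (lookup-strict xs i))

  opposite-+ : (j : Fin n) → suc (toℕ (opposite j)) ℕ.+ toℕ j ≡ n
  opposite-+ {n} j = begin
    suc (toℕ (opposite j)) ℕ.+ toℕ j ≡⟨ ℕ.+-suc (toℕ (opposite j)) (toℕ j) ⟨
    toℕ (opposite j) ℕ.+ suc (toℕ j) ≡⟨ ≡.cong (ℕ._+ suc (toℕ j)) (Fin.opposite-prop j) ⟩
    n ℕ.∸ suc (toℕ j) ℕ.+ suc (toℕ j) ≡⟨ ℕ.m∸n+n≡m (Fin.toℕ<n j) ⟩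
    n ∎
    where open ≡.≡-Reasoning

  -- Here `c` is the letter kᵢ = n + x - i and `s` = n - j is the 1-based number of the column
  -- opposite to `j`, so that n cancels.
  reindex : ∀ c i x s j {n} → c ℕ.+ i ≡ n ℕ.+ x → s ℕ.+ j ≡ n →
    + c ℤ.- + s ≡ + x ℤ.- + i ℤ.+ + j
  reindex c i x s j c+i s+j = begin
    + c ℤ.- + s                            ≡⟨ lem₁ (+ c) (+ s) (+ i) ⟩
    (+ c ℤ.+ + i) ℤ.- + i ℤ.- + s          ≡⟨ ≡.cong (λ z → z ℤ.- + i ℤ.- + s) eq ⟩
    (+ s ℤ.+ + j) ℤ.+ + x ℤ.- + i ℤ.- + s  ≡⟨ lem₂ (+ s) (+ j) (+ x) (+ i) ⟩
    + x ℤ.- + i ℤ.+ + j                    ∎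
    where
    open ≡.≡-Reasoning
    lem₁ : ∀ c s i → c ℤ.- s ≡ (c ℤ.+ i) ℤ.- i ℤ.- s
    lem₁ = ℤ-solver.solve-∀
    lem₂ : ∀ s j x i → (s ℤ.+ j) ℤ.+ x ℤ.- i ℤ.- s ≡ x ℤ.- i ℤ.+ j
    lem₂ = ℤ-solver.solve-∀
    eq : + c ℤ.+ + i ≡ (+ s ℤ.+ + j) ℤ.+ + x
    eq = ≡.cong +_ (≡.trans c+i (≡.cong (ℕ._+ x) (≡.sym s+j)))

  -- The letter 0 is left out: h_{0 - j} is zero for every column j ≥ 1, so the summands k = 0 of
  -- the first array and l = 0 of the second vanish.
  down : ℕ → List ℕ
  down = applyDownFrom suc

  ∈-down : ∀ {k N} → suc k ℕ.≤ N → suc k ∈ down N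
  ∈-down {k} {suc N} k<N with k ℕ.≟ N
  ... | yes refl = here refl
  ... | no  k≢N  = there (∈-down (ℕ.≤∧≢⇒< (ℕ.s≤s⁻¹ k<N) k≢N))

  down-≤ : ∀ N → All (ℕ._≤ N) (down N)
  down-≤ zero    = []
  down-≤ (suc N) = ℕ.≤-refl ∷ All.map ℕ.m≤n⇒m≤1+n (down-≤ N)

  down-unique : ∀ N → Unique (down N)
  down-unique N = Unique.applyDownFrom⁺₁ suc N λ j<i _ i≡j → ℕ.<⇒≢ j<i (sym (ℕ.suc-injective i≡j))

  comb-short : ∀ n (xs : List A) → length xs ℕ.< n → comb n xs ≡ []
  comb-short (suc n) []       _               = refl
  comb-short (suc n) (x ∷ xs) (ℕ.s≤s len) = cong₂ _++_
    (cong (List.map (x ∷_)) (comb-short n xs len)) (comb-short (suc n) xs (ℕ.m≤n⇒m≤1+n len))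

  -- Partitions with at most `n` parts, none above `d`. Taking `suc d` as first part or lowering the
  -- bound mirrors the recursion of `comb` on `down (n + d)`, where the largest letter is taken or
  -- skipped.
  shapes : (n d : ℕ) → List (List ℕ)
  shapes zero    d       = [] ∷ []
  shapes (suc n) zero    = [] ∷ []
  shapes (suc n) (suc d) = List.map (suc d ∷_) (shapes n (suc d)) ++ shapes (suc n) d

  shapes-0 : ∀ n → shapes n 0 ≡ [] ∷ []
  shapes-0 zero    = refl
  shapes-0 (suc n) = refl

  comb-down : ∀ n d → comb n (down (n ℕ.+ d)) ≡ List.map (strict n) (shapes n d)
  comb-down zero    d    = refl
  comb-down (suc n) zero = cong₂ _++_
    (trans (cong (List.map _) (trans (comb-down n 0) (cong (List.map (strict n)) (shapes-0 n))))
           (cong (λ k → (suc k ∷ strict n []) ∷ []) (ℕ.+-identityʳ n)))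
    -- Without the largest letter only n letters are left for n + 1 places.
    (comb-short (suc n) (down (n ℕ.+ 0)) (subst (ℕ._< suc n)
      (sym (trans (List.length-applyDownFrom suc (n ℕ.+ 0)) (ℕ.+-identityʳ n))) (ℕ.n<1+n n)))
  comb-down (suc n) (suc d) = begin
    List.map (suc (n ℕ.+ suc d) ∷_) (comb n (down (n ℕ.+ suc d))) ++ comb (suc n) (down (n ℕ.+ suc d))
      ≡⟨ cong₂ (λ ws k → List.map (suc (n ℕ.+ suc d) ∷_) ws ++ comb (suc n) (down k))
           (comb-down n (suc d)) (ℕ.+-suc n d) ⟩
    List.map (suc (n ℕ.+ suc d) ∷_) (List.map (strict n) (shapes n (suc d))) ++ comb (suc n) (down (suc n ℕ.+ d))
      ≡⟨ cong₂ _++_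
           (trans (sym (List.map-∘ (shapes n (suc d)))) (List.map-∘ (shapes n (suc d)))) (comb-down (suc n) d) ⟩
    List.map (strict (suc n)) (List.map (suc d ∷_) (shapes n (suc d))) ++ List.map (strict (suc n)) (shapes (suc n) d)
      ≡⟨ List.map-++ (strict (suc n)) (List.map (suc d ∷_) (shapes n (suc d))) _ ⟨
    List.map (strict (suc n)) (shapes (suc n) (suc d)) ∎
    where open ≡.≡-Reasoning

  Shape : (n d : ℕ) → List ℕ → Set
  Shape n d xs = All (0 ℕ.<_) xs × Linked _≥_ (d ∷ xs) × length xs ℕ.≤ n

  raise : ∀ {d xs} → Linked _≥_ (d ∷ xs) → Linked _≥_ (suc d ∷ xs)
  raise [-]       = [-]
  raise (p ∷ dec) = ℕ.m≤n⇒m≤1+n p ∷ dec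

  shapes-sound : ∀ n d → All (Shape n d) (shapes n d)
  shapes-sound zero    d       = ([] , [-] , ℕ.z≤n) ∷ []
  shapes-sound (suc n) zero    = ([] , [-] , ℕ.z≤n) ∷ []
  shapes-sound (suc n) (suc d) = All.++⁺
    (All.map⁺ (All.map (λ (pos , dec , len) → ℕ.s≤s ℕ.z≤n ∷ pos , ℕ.≤-refl ∷ dec , ℕ.s≤s len)
      (shapes-sound n (suc d))))
    (All.map (Product.map₂ (Product.map₁ raise)) (shapes-sound (suc n) d))

  shapes-unique : ∀ n d → Unique (shapes n d)
  shapes-unique zero    d       = [] ∷ []
  shapes-unique (suc n) zero    = [] ∷ []
  shapes-unique (suc n) (suc d) = Unique.++⁺
    (Unique.map⁺ List.∷-injectiveʳ (shapes-unique n (suc d)))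
    (shapes-unique (suc n) d)
    disjoint
    where
    disjoint : ∀ {xs} → ¬ (xs ∈ List.map (suc d ∷_) (shapes n (suc d)) × xs ∈ shapes (suc n) d)
    disjoint (∈ˡ , ∈ʳ) with ∈-map⁻ (suc d ∷_) ∈ˡ | All.lookup (shapes-sound (suc n) d) ∈ʳ
    ... | _ , _ , refl | _ , d≥d+1 ∷ _ , _ = ℕ.1+n≰n d≥d+1

  shapes-complete : ∀ n d {xs} → Shape n d xs → xs ∈ shapes n d
  shapes-complete zero    d       {[]}     _ = here refl
  shapes-complete (suc n) zero    {[]}     _ = here refl
  shapes-complete (suc n) zero    {x ∷ xs} (0<x ∷ _ , 0≥x ∷ _ , _) = contradiction 0≥x (ℕ.<⇒≱ 0<x)
  shapes-complete (suc n) (suc d) {[]}     _ =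
    ∈-++⁺ʳ (List.map (suc d ∷_) (shapes n (suc d))) (shapes-complete (suc n) d ([] , [-] , ℕ.z≤n))
  shapes-complete (suc n) (suc d) {x ∷ xs} (0<x ∷ pos , d≥x ∷ dec , ℕ.s≤s len) with x ℕ.≟ suc d
  ... | yes refl = ∈-++⁺ˡ (∈-map⁺ (suc d ∷_) (shapes-complete n (suc d) (pos , dec , len)))
  ... | no  x≢   = ∈-++⁺ʳ (List.map (suc d ∷_) (shapes n (suc d)))
    (shapes-complete (suc n) d (0<x ∷ pos , ℕ.s≤s⁻¹ (ℕ.≤∧≢⇒< d≥x x≢) ∷ dec , ℕ.s≤s len))

  module _ {n : ℕ} where
    partsOf : Partition≤ n → List ℕ
    partsOf = parts ∘ proj₁

    partsOf-injective : ∀ {p q : Partition≤ n} → partsOf p ≡ partsOf q → p ≡ q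
    partsOf-injective {mkPartition xs pos dec , len} {mkPartition .xs pos′ dec′ , len′} refl
      with refl ← All.irrelevant ℕ.<-irrelevant pos pos′
         | refl ← Linked.irrelevant ℕ.≤-irrelevant dec dec′
         | refl ← ℕ.≤-irrelevant len len′ = refl

    fromShape : ∀ {d xs} → Shape n d xs → Partition≤ n
    fromShape (pos , dec , len) = mkPartition _ pos (Linked.tail dec) , len

    fromShapes : ∀ {d xss} → All (Shape n d) xss → List (Partition≤ n)
    fromShapes []       = []
    fromShapes (p ∷ ps) = fromShape p ∷ fromShapes ps

    map-fromShapes : ∀ {d xss} (ps : All (Shape n d) xss) → List.map partsOf (fromShapes ps) ≡ xss
    map-fromShapes []       = refl
    map-fromShapes (p ∷ ps) = cong (_ ∷_) (map-fromShapes ps)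

  partitions : (n d : ℕ) → List (Partition≤ n)
  partitions n d = fromShapes (shapes-sound n d)

  partitions-unique : ∀ n d → Unique (partitions n d)
  partitions-unique n d =
    Unique.map⁻ (subst Unique (sym (map-fromShapes (shapes-sound n d))) (shapes-unique n d))

  partitions-complete : ∀ n d {p : Partition≤ n} → Linked _≥_ (d ∷ partsOf p) → p ∈ partitions n d
  partitions-complete n d {p} dec with ∈-map⁻ partsOf
    (subst (partsOf p ∈_) (sym (map-fromShapes (shapes-sound n d)))
      (shapes-complete n d (positive (proj₁ p) , dec , proj₂ p)))
  ... | q , q∈ , eq = subst (_∈ partitions n d) (sym (partsOf-injective eq)) q∈

  pairs-unique : {xs : List A} → Unique xs → Unique (pairs xs)
  pairs-unique []                           = []
  pairs-unique {xs = x ∷ xs} (x∉xs ∷ unique) = Unique.++⁺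
    (Unique.map⁺ (cong proj₂) unique) (pairs-unique unique) disjoint
    where
    pairs-fst : ∀ {y z} ys → (y , z) ∈ pairs ys → y ∈ ys
    pairs-fst (w ∷ ys) ∈ with ∈-++⁻ (List.map (w ,_) ys) ∈
    ... | inj₁ ∈ˡ with ∈-map⁻ (w ,_) ∈ˡ
    ...   | _ , _ , refl = here refl
    pairs-fst (w ∷ ys) ∈ | inj₂ ∈ʳ = there (pairs-fst ys ∈ʳ)
    disjoint : ∀ {p} → ¬ (p ∈ List.map (x ,_) xs × p ∈ pairs xs)
    disjoint (∈ˡ , ∈ʳ) with ∈-map⁻ (x ,_) ∈ˡ
    ... | _ , _ , refl = All.lookup x∉xs (pairs-fst xs ∈ʳ) refl

  pairs-descend : ∀ N → All (λ (p , l) → l ℕ.< p) (pairs (down N))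
  pairs-descend zero    = []
  pairs-descend (suc N) = All.++⁺ (All.map⁺ (All.map ℕ.s≤s (down-≤ N))) (pairs-descend N)

  ∈-pairs-down : ∀ {p l N} → suc l ℕ.< p → p ℕ.≤ N → (p , suc l) ∈ pairs (down N)
  ∈-pairs-down {p} {l} {zero}  l<p p≤N = contradiction p≤N (ℕ.<⇒≱ (ℕ.≤-<-trans ℕ.z≤n l<p))
  ∈-pairs-down {p} {l} {suc N} l<p p≤N with p ℕ.≟ suc N
  ... | yes refl = ∈-++⁺ˡ (∈-map⁺ (suc N ,_) (∈-down (ℕ.s≤s⁻¹ l<p)))
  ... | no  p≢   = ∈-++⁺ʳ (List.map (suc N ,_) (down N)) (∈-pairs-down l<p (ℕ.s≤s⁻¹ (ℕ.≤∧≢⇒< p≤N p≢)))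

  -- Summation pairs (k , l) correspond to decreasing pairs k + l + 1 > l.
  columns differences : ℕ × ℕ → ℕ × ℕ
  columns     (k , l) = k ℕ.+ l ℕ.+ 1 , l
  differences (p , l) = p ℕ.∸ suc l , l

  columns-differences : ∀ {p l} → l ℕ.< p → columns (differences (p , l)) ≡ (p , l)
  columns-differences {p} {l} l<p = cong (_, l) (trans
    (trans (ℕ.+-assoc (p ℕ.∸ suc l) l 1) (cong (p ℕ.∸ suc l ℕ.+_) (ℕ.+-comm l 1))) (ℕ.m∸n+n≡m l<p))

  differences-columns : ∀ kl → differences (columns kl) ≡ kl
  differences-columns (k , l) = cong (_, l) (trans
    (cong (ℕ._∸ suc l) (trans (ℕ.+-assoc k l 1) (cong (k ℕ.+_) (ℕ.+-comm l 1)))) (ℕ.m+n∸n≡m k (suc l)))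

  -- All (k , l) with l ≥ 1 and k + l + 1 ≤ N: the finite part of the double sum that survives
  -- truncation.
  indices : ℕ → List (ℕ × ℕ)
  indices N = List.map differences (pairs (down N))

  columns-indices : ∀ N → List.map columns (indices N) ≡ pairs (down N)
  columns-indices N = trans (sym (List.map-∘ (pairs (down N)))) (trans
    (List.map-cong-local (All.map (λ {(p , l)} → columns-differences) (pairs-descend N)))
    (List.map-id (pairs (down N))))

  indices-unique : ∀ N → Unique (indices N)
  indices-unique N = Unique.map⁻ (subst Unique (sym (columns-indices N)) (pairs-unique (down-unique N)))

  ∈-indices : ∀ {k l N} → k ℕ.+ suc l ℕ.+ 1 ℕ.≤ N → (k , suc l) ∈ indices N
  ∈-indices {k} {l} {N} ≤N = subst (_∈ indices N) (differences-columns (k , suc l))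
    (∈-map⁺ differences (∈-pairs-down l<p ≤N))
    where
    l<p : suc l ℕ.< k ℕ.+ suc l ℕ.+ 1
    l<p = subst (suc l ℕ.<_) (ℕ.+-comm 1 (k ℕ.+ suc l)) (ℕ.s≤s (ℕ.m≤n+m (suc l) k))

open Shapes

-- Alternating functions of words

module Alternating (R : CommutativeRing 0ℓ 0ℓ)
  (halve : ∀ x → CommutativeRing._≈_ R x (CommutativeRing.-_ R x) →
           CommutativeRing._≈_ R x (CommutativeRing.0# R)) where

  open CommutativeRing R
  open import Relation.Binary.Reasoning.Setoid setoid
  open import Algebra.Properties.Ring ring
    using (-‿distribˡ-*; -‿distribʳ-*; -‿involutive; -0#≈0#)
  open import Algebra.Properties.Semiring.Exp semiring using (_^_)
  open import Algebra.Properties.Semiring.Mult semiring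
    using (×-assocˡ; ×-congʳ) renaming (_×_ to infixr 7 _·_)
  open import Algebra.Properties.CommutativeMonoid.Mult +-commutativeMonoid
    using (×-distrib-+)
  open SemiringSolver commutativeSemiring using (solve; _:=_; _:+_; _:*_)
  open RingSums R public
  open Sum using () renaming (fold to ∑)
  open Prod using () renaming (fold to ∏)

  ∑-words : ∀ n (xs : List A) (f : Vec A (suc n) → Carrier) →
    ∑ (words (suc n) xs) f ≈ ∑ xs (λ x → ∑ (words n xs) (λ w → f (x ∷ w)))
  ∑-words n xs f = Sum.fold-product _∷_ xs (words n xs) f

  ∏∑ : ∀ n (xs : List A) (f : Fin n → A → Carrier) →
    ∏ (allFin n) (λ i → ∑ xs (f i)) ≈ ∑ (words n xs) (λ w → ∏ (allFin n) (λ i → f i (lookup w i)))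
  ∏∑ zero    xs f = sym (+-identityʳ 1#)
  ∏∑ (suc n) xs f = begin
    ∏ (allFin (suc n)) (λ i → ∑ xs (f i))
      ≡⟨ Prod.fold-suc n _ ⟩
    ∑ xs (f Fin.zero) * ∏ (allFin n) (λ i → ∑ xs (f (Fin.suc i)))
      ≈⟨ *-congˡ (∏∑ n xs (f ∘ Fin.suc)) ⟩
    ∑ xs (f Fin.zero) * ∑ (words n xs) (λ w → ∏ (allFin n) (λ i → f (Fin.suc i) (lookup w i)))
      ≈⟨ ∑-distribʳ _ xs _ ⟨
    ∑ xs (λ x → f Fin.zero x * ∑ (words n xs) (λ w → ∏ (allFin n) (λ i → f (Fin.suc i) (lookup w i))))
      ≈⟨ Sum.fold-cong xs (λ x → ∑-distribˡ _ (words n xs) _) ⟨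
    ∑ xs (λ x → ∑ (words n xs) (λ w → f Fin.zero x * ∏ (allFin n) (λ i → f (Fin.suc i) (lookup w i))))
      ≈⟨ Sum.fold-cong xs (λ x → Sum.fold-cong (words n xs) λ w → reflexive (Prod.fold-suc n _)) ⟨
    ∑ xs (λ x → ∑ (words n xs) (λ w → ∏ (allFin (suc n)) (λ i → f i (lookup (x ∷ w) i))))
      ≈⟨ ∑-words n xs _ ⟨
    ∑ (words (suc n) xs) (λ w → ∏ (allFin (suc n)) (λ i → f i (lookup w i))) ∎

  Alternates Symmetric : (Vec A n → Carrier) → Set _
  Alternates F = ∀ {v w} → Swap v w → F v ≈ - F w
  Symmetric  F = ∀ {v w} → Swap v w → F v ≈ F w

  repeat-zero : (F : Vec A (suc (suc n)) → Carrier) → Alternates F → ∀ x w → F (x ∷ x ∷ w) ≈ 0#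
  repeat-zero F alt x w = halve _ (alt here)

  -- Signs and determinants on arbitrary words

  sg : Fin N → Fin N → Carrier
  sg Fin.zero    Fin.zero    = 0#
  sg Fin.zero    (Fin.suc _) = 1#
  sg (Fin.suc _) Fin.zero    = - 1#
  sg (Fin.suc i) (Fin.suc j) = sg i j

  sg-anti : (i j : Fin N) → sg i j ≈ - sg j i
  sg-anti Fin.zero    Fin.zero    = sym -0#≈0#
  sg-anti Fin.zero    (Fin.suc _) = sym (-‿involutive 1#)
  sg-anti (Fin.suc _) Fin.zero    = refl
  sg-anti (Fin.suc i) (Fin.suc j) = sg-anti i j

  rowSign : Fin N → Vec (Fin N) n → Carrier
  rowSign x []      = 1#
  rowSign x (y ∷ w) = sg x y * rowSign x w

  -- Zero unless the letters are distinct, so that sums over 𝔖 extend to all words.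
  sign : Vec (Fin N) n → Carrier
  sign []      = 1#
  sign (x ∷ w) = rowSign x w * sign w

  rowSign-swap : (x : Fin N) → Symmetric (rowSign {n = n} x)
  rowSign-swap x (here {y = y} {w = w}) =
    solve 3 (λ a b c → a :* (b :* c) := b :* (a :* c)) refl _ _ _
  rowSign-swap x (there s) = *-congˡ (rowSign-swap x s)

  sign-alternates : Alternates (sign {N} {n})
  sign-alternates (here {x = x} {y} {w}) = begin
    sg x y * rowSign x w * (rowSign y w * sign w)
      ≈⟨ *-congʳ (*-congʳ (sg-anti x y)) ⟩
    - sg y x * rowSign x w * (rowSign y w * sign w)
      ≈⟨ *-congʳ (-‿distribˡ-* _ _) ⟨
    - (sg y x * rowSign x w) * (rowSign y w * sign w)
      ≈⟨ -‿distribˡ-* _ _ ⟨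
    - (sg y x * rowSign x w * (rowSign y w * sign w))
      ≈⟨ -‿cong (solve 4 (λ a b c d → a :* b :* (c :* d) := a :* c :* (b :* d)) refl _ _ _ _) ⟩
    - (sg y x * rowSign y w * (rowSign x w * sign w)) ∎
  sign-alternates (there {x = x} s) = trans
    (*-cong (rowSign-swap x s) (sign-alternates s)) (sym (-‿distribʳ-* _ _))

  pairing : (A → B → Carrier) → Vec A n → Vec B n → Carrier
  pairing a []      []      = 1#
  pairing a (x ∷ v) (u ∷ w) = a x u * pairing a v w

  ∏-pairing : (a : A → B → Carrier) (v : Vec A n) (w : Vec B n) →
    ∏ (allFin n) (λ i → a (lookup v i) (lookup w i)) ≈ pairing a v w
  ∏-pairing a []      []      = refl
  ∏-pairing a (x ∷ v) (u ∷ w) = trans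
    (reflexive (Prod.fold-suc _ λ i → a (lookup (x ∷ v) i) (lookup (u ∷ w) i))) (*-congˡ (∏-pairing a v w))

  transform : List B → (A → B → Carrier) → (Vec B n → Carrier) → Vec A n → Carrier
  transform ys a G v = ∑ (words _ ys) (λ w → G w * pairing a v w)

  transform-∷ : (ys : List B) (a : A → B → Carrier) (G : Vec B (suc n) → Carrier) → ∀ x v →
    transform ys a G (x ∷ v) ≈ ∑ ys (λ u → a x u * transform ys a (λ w → G (u ∷ w)) v)
  transform-∷ {n = n} ys a G x v = trans (∑-words n ys _) (Sum.fold-cong ys λ u → trans
    (Sum.fold-cong (words n ys) λ w → solve 3 (λ a b c → a :* (b :* c) := b :* (a :* c)) refl _ _ _)
    (∑-distribˡ (a x u) (words n ys) _))

  transform-cong : (ys : List B) (a : A → B → Carrier) {G H : Vec B n → Carrier} →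
    (∀ w → G w ≈ H w) → ∀ v → transform ys a G v ≈ transform ys a H v
  transform-cong ys a G≈H v = Sum.fold-cong (words _ ys) λ w → *-congʳ (G≈H w)

  transform-neg : (ys : List B) (a : A → B → Carrier) (G : Vec B n → Carrier) → ∀ v →
    transform ys a (λ w → - G w) v ≈ - transform ys a G v
  transform-neg {n = n} ys a G v = trans
    (Sum.fold-cong (words n ys) λ w → sym (-‿distribˡ-* _ _)) (∑-neg (words n ys) _)

  transform-∷∷ : (ys : List B) (a : A → B → Carrier) (G : Vec B (suc (suc n)) → Carrier) → ∀ x y v →
    transform ys a G (x ∷ y ∷ v) ≈
    ∑ ys (λ u → ∑ ys (λ t → a x u * (a y t * transform ys a (λ w → G (u ∷ t ∷ w)) v)))
  transform-∷∷ ys a G x y v = trans (transform-∷ ys a G x (y ∷ v)) (Sum.fold-cong ys λ u → trans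
    (*-congˡ (transform-∷ ys a (λ w → G (u ∷ w)) y v)) (sym (∑-distribˡ _ ys _)))

  -- Exchanging two rows is undone by exchanging the names of the columns summed over for them, at
  -- the cost of the sign of `G`. Swaps further down are handled with the first column fixed.
  transform-alternates : (ys : List B) (a : A → B → Carrier) (G : Vec B n → Carrier) →
    Alternates G → Alternates (transform ys a G)
  transform-alternates ys a G alt (here {x = x} {y} {v}) = begin
    transform ys a G (x ∷ y ∷ v)
      ≈⟨ transform-∷∷ ys a G x y v ⟩
    ∑ ys (λ u → ∑ ys (λ t → a x u * (a y t * T u t)))
      ≈⟨ Sum.fold-swap ys ys _ ⟩
    ∑ ys (λ t → ∑ ys (λ u → a x u * (a y t * T u t)))
      ≈⟨ Sum.fold-cong ys (λ t → Sum.fold-cong ys λ u →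
           trans (solve 3 (λ a b c → a :* (b :* c) := b :* (a :* c)) refl _ _ _)
           (trans (*-congˡ (trans (*-congˡ (antisymmetric u t)) (sym (-‿distribʳ-* _ _))))
           (sym (-‿distribʳ-* _ _)))) ⟩
    ∑ ys (λ t → ∑ ys (λ u → - (a y t * (a x u * T t u))))
      ≈⟨ Sum.fold-cong ys (λ t → ∑-neg ys _) ⟩
    ∑ ys (λ t → - ∑ ys (λ u → a y t * (a x u * T t u)))
      ≈⟨ ∑-neg ys _ ⟩
    - ∑ ys (λ t → ∑ ys (λ u → a y t * (a x u * T t u)))
      ≈⟨ -‿cong (transform-∷∷ ys a G y x v) ⟨
    - transform ys a G (y ∷ x ∷ v) ∎
    where
    T : _ → _ → Carrier
    T u t = transform ys a (λ w → G (u ∷ t ∷ w)) v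
    antisymmetric : ∀ u t → T u t ≈ - T t u
    antisymmetric u t = trans (transform-cong ys a (λ w → alt here) v) (transform-neg ys a _ v)
  transform-alternates ys a G alt (there {x = x} {v} {w} s) = begin
    transform ys a G (x ∷ v)
      ≈⟨ transform-∷ ys a G x v ⟩
    ∑ ys (λ u → a x u * transform ys a (λ w → G (u ∷ w)) v)
      ≈⟨ Sum.fold-cong ys (λ u → trans
           (*-congˡ (transform-alternates ys a (λ w → G (u ∷ w)) (λ s → alt (there s)) s))
           (sym (-‿distribʳ-* _ _))) ⟩
    ∑ ys (λ u → - (a x u * transform ys a (λ w → G (u ∷ w)) w))
      ≈⟨ ∑-neg ys _ ⟩
    - ∑ ys (λ u → a x u * transform ys a (λ w → G (u ∷ w)) w)
      ≈⟨ -‿cong (transform-∷ ys a G x w) ⟨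
    - transform ys a G (x ∷ w) ∎


  -- Sums of symmetric functions over all words

  ·-zero : ∀ n {x} → x ≈ 0# → n · x ≈ 0#
  ·-zero zero    x≈0 = refl
  ·-zero (suc n) x≈0 = trans (+-cong x≈0 (·-zero n x≈0)) (+-identityˡ 0#)

  ∑-· : ∀ n (xs : List A) f → ∑ xs (λ x → n · f x) ≈ n · ∑ xs f
  ∑-· zero    xs f = Sum.fold-ε xs λ _ → refl
  ∑-· (suc n) xs f = trans (Sum.fold-∙ xs f _) (+-congˡ (∑-· n xs f))

  -- Two swaps carry `z` behind both clashing letters, which then stand in front.
  clash-∷ : (g : I → A) (H : Vec A (suc n) → Carrier) → Symmetric H →
    (∀ {v} → Clash g v → H v ≈ 0#) → ∀ z {v} → Clash g v → H (z ∷ v) ≈ 0#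
  clash-∷ g H sym-H kill z clash = trans (sym-H here) (trans (sym-H (there here)) (kill clash))

  -- Words with two letters g i contribute nothing, and symmetry moves a single one to the front.
  ∑-words-++ : ∀ n (g : I → A) is zs (H : Vec A (suc n) → Carrier) → Symmetric H →
    (∀ {v} → Clash g v → H v ≈ 0#) →
    ∑ (words (suc n) (List.map g is ++ zs)) H ≈
    ∑ (words (suc n) zs) H + suc n · ∑ is (λ i → ∑ (words n zs) (λ w → H (g i ∷ w)))
  ∑-words-++ {A = A} n g is zs H sym-H kill = begin
    ∑ (words (suc n) xs) H
      ≈⟨ ∑-words n xs H ⟩
    ∑ xs (λ x → ∑ (words n xs) (λ w → H (x ∷ w)))
      ≈⟨ Sum.fold-++ (List.map g is) zs _ ⟩
    ∑ (List.map g is) (λ x → ∑ (words n xs) (λ w → H (x ∷ w))) + ∑ zs (λ z → ∑ (words n xs) (λ w → H (z ∷ w)))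
      ≈⟨ +-congʳ (reflexive (Sum.fold-map g is _)) ⟩
    ∑ is (λ i → ∑ (words n xs) (λ w → H (g i ∷ w))) + ∑ zs (λ z → ∑ (words n xs) (λ w → H (z ∷ w)))
      ≈⟨ step n H sym-H kill ⟩
    ∑ (words (suc n) zs) H + suc n · ∑ is (λ i → ∑ (words n zs) (λ w → H (g i ∷ w))) ∎
    where
    xs : List A
    xs = List.map g is ++ zs
    step : ∀ n (H : Vec A (suc n) → Carrier) → Symmetric H → (∀ {v} → Clash g v → H v ≈ 0#) →
      ∑ is (λ i → ∑ (words n xs) (λ w → H (g i ∷ w))) + ∑ zs (λ z → ∑ (words n xs) (λ w → H (z ∷ w))) ≈
      ∑ (words (suc n) zs) H + suc n · ∑ is (λ i → ∑ (words n zs) (λ w → H (g i ∷ w)))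
    step zero    H sym-H kill = trans (+-comm _ _)
      (+-cong (sym (∑-words 0 zs H)) (sym (+-identityʳ _)))
    step (suc n) H sym-H kill = begin
      ∑ is (λ i → ∑ (words (suc n) xs) (λ w → H (g i ∷ w))) + ∑ zs (λ z → ∑ (words (suc n) xs) (λ w → H (z ∷ w)))
        ≈⟨ +-cong
             (Sum.fold-cong is λ i → trans
               (∑-words-++ n g is zs (λ w → H (g i ∷ w)) (sym-H ∘ there) (clash-∷ g H sym-H kill (g i)))
               (trans (+-congˡ (·-zero (suc n) (Sum.fold-ε is λ j → Sum.fold-ε (words n zs) λ w → kill clash)))
                      (+-identityʳ _)))
             (Sum.fold-cong zs λ z →
               ∑-words-++ n g is zs (λ w → H (z ∷ w)) (sym-H ∘ there) (clash-∷ g H sym-H kill z)) ⟩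
      X + ∑ zs (λ z → ∑ (words (suc n) zs) (λ w → H (z ∷ w)) + suc n · ∑ is (λ i → ∑ (words n zs) (λ w → H (z ∷ g i ∷ w))))
        ≈⟨ +-congˡ (trans (Sum.fold-∙ zs _ _) (+-cong (sym (∑-words (suc n) zs H)) (∑-· (suc n) zs _))) ⟩
      X + (∑ (words (suc (suc n)) zs) H + suc n · ∑ zs (λ z → ∑ is (λ i → ∑ (words n zs) (λ w → H (z ∷ g i ∷ w)))))
        ≈⟨ +-congˡ (+-congˡ (×-congʳ (suc n) (trans (Sum.fold-swap zs is _) (Sum.fold-cong is λ i → trans
             (Sum.fold-cong zs λ z → Sum.fold-cong (words n zs) λ w → sym-H here)
             (sym (∑-words n zs _)))))) ⟩
      X + (∑ (words (suc (suc n)) zs) H + suc n · X)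
        ≈⟨ solve 3 (λ x y z → x :+ (y :+ z) := y :+ (x :+ z)) refl X _ _ ⟩
      ∑ (words (suc (suc n)) zs) H + suc (suc n) · X ∎
      where
      X : Carrier
      X = ∑ is (λ i → ∑ (words (suc n) zs) (λ w → H (g i ∷ w)))

  ∑-comb : ∀ n x (xs : List A) (H : Vec A (suc n) → Carrier) →
    ∑ (comb (suc n) (x ∷ xs)) H ≈ ∑ (comb n xs) (λ w → H (x ∷ w)) + ∑ (comb (suc n) xs) H
  ∑-comb n x xs H = trans (Sum.fold-++ (List.map (x ∷_) (comb n xs)) _ H)
    (+-congʳ (reflexive (Sum.fold-map (x ∷_) (comb n xs) H)))

  factorial-step : ∀ n {a b} → suc n ! · a + suc n · (n ! · b) ≈ suc n ! · (b + a)
  factorial-step n {a} {b} = begin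
    suc n ! · a + suc n · (n ! · b) ≈⟨ +-congˡ (×-assocˡ b (suc n) (n !)) ⟩
    suc n ! · a + suc n ! · b       ≈⟨ ×-distrib-+ a b (suc n !) ⟨
    suc n ! · (a + b)               ≈⟨ ×-congʳ (suc n !) (+-comm a b) ⟩
    suc n ! · (b + a)               ∎

  -- A word that counts contains the first letter `x` of the list at most once. The cases of no `x`
  -- and one `x` match the two branches of `comb`, and the n + 1 possible places of `x` build up the
  -- factorial.
  ∑-symmetric : ∀ n (xs : List A) (H : Vec A n → Carrier) → Symmetric H →
    (∀ x {v} → Clash {I = ⊤} (λ _ → x) v → H v ≈ 0#) → ∑ (words n xs) H ≈ n ! · ∑ (comb n xs) H
  ∑-symmetric zero    xs       H sym-H kill = sym (+-identityʳ _)
  ∑-symmetric (suc n) []       H sym-H kill = sym (·-zero (suc n !) refl)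
  ∑-symmetric (suc n) (x ∷ xs) H sym-H kill = begin
    ∑ (words (suc n) (x ∷ xs)) H
      ≈⟨ ∑-words-++ n (λ (_ : ⊤) → x) (tt ∷ []) xs H sym-H (kill x) ⟩
    ∑ (words (suc n) xs) H + suc n · (∑ (words n xs) (λ w → H (x ∷ w)) + 0#)
      ≈⟨ +-cong (∑-symmetric (suc n) xs H sym-H kill) (×-congʳ (suc n) (trans (+-identityʳ _)
           (∑-symmetric n xs (λ w → H (x ∷ w)) (sym-H ∘ there) λ y → clash-∷ _ H sym-H (kill y) x))) ⟩
    suc n ! · ∑ (comb (suc n) xs) H + suc n · (n ! · ∑ (comb n xs) (λ w → H (x ∷ w)))
      ≈⟨ factorial-step n ⟩
    suc n ! · (∑ (comb n xs) (λ w → H (x ∷ w)) + ∑ (comb (suc n) xs) H)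
      ≈⟨ ×-congʳ (suc n !) (∑-comb n x xs H) ⟨
    suc n ! · ∑ (comb (suc n) (x ∷ xs)) H ∎

  -- Alternating functions on words of pairs

  neg-neg : ∀ {x y z} → x ≈ - y → y ≈ - z → x ≈ z
  neg-neg p q = trans p (trans (-‿cong q) (-‿involutive _))

  -- Exchanging two neighbouring pairs takes four adjacent swaps, an even number.
  flatten-symmetric : ∀ n (G : Vec A (n ℕ.* 2) → Carrier) → Alternates G → Symmetric {n = n} (G ∘ flatten)
  flatten-symmetric _ G alt here      =
    trans (neg-neg (alt (there here)) (alt here)) (neg-neg (alt (there (there here))) (alt (there here)))
  flatten-symmetric (suc n) G alt (there s) = flatten-symmetric n (λ w → G (_ ∷ _ ∷ w)) (λ s → alt (there (there s))) s

  flatten-clash : ∀ n (G : Vec A (n ℕ.* 2) → Carrier) → Alternates G → ∀ x {v : Vec (A × A) n} →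
    Clash (x ,_) v → G (flatten v) ≈ 0#
  flatten-clash _ G alt x clash = trans (alt (there here))
    (trans (-‿cong (repeat-zero G alt x _)) -0#≈0#)

  ∑-antisymmetric : ∀ (xs : List A) (T : A → A → Carrier) → (∀ y z → T y z ≈ - T z y) →
    ∑ xs (λ y → ∑ xs (T y)) ≈ 0#
  ∑-antisymmetric xs T anti = halve _ (begin
    ∑ xs (λ y → ∑ xs (T y))             ≈⟨ Sum.fold-swap xs xs T ⟩
    ∑ xs (λ z → ∑ xs (λ y → T y z))     ≈⟨ Sum.fold-cong xs (λ z → Sum.fold-cong xs λ y → anti y z) ⟩
    ∑ xs (λ z → ∑ xs (λ y → - T z y))   ≈⟨ Sum.fold-cong xs (λ z → ∑-neg xs (T z)) ⟩
    ∑ xs (λ z → - ∑ xs (T z))           ≈⟨ ∑-neg xs _ ⟩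
    - ∑ xs (λ z → ∑ xs (T z))           ∎)

  mutual
    -- This is the row expansion of the Pfaffian of ones. The pairs that contain `x` are (x , y)
    -- with `y` in `xs`, and at most one of them occurs in a nonzero term. Moved to the front, it
    -- leaves behind `x` an odd word whose first letter `y` runs through all of `xs`.
    ∑-alternating : ∀ n (xs : List A) (G : Vec A (n ℕ.* 2) → Carrier) → Alternates G →
      ∑ (words n (pairs xs)) (G ∘ flatten) ≈ n ! · ∑ (comb (n ℕ.* 2) xs) G
    ∑-alternating zero    xs       G alt = sym (+-identityʳ _)
    ∑-alternating (suc n) []       G alt = sym (·-zero (suc n !) refl)
    ∑-alternating (suc n) (x ∷ xs) G alt = begin
      ∑ (words (suc n) (pairs (x ∷ xs))) (G ∘ flatten)
        ≈⟨ ∑-words-++ n (x ,_) xs (pairs xs) (G ∘ flatten) (flatten-symmetric (suc n) G alt) (flatten-clash (suc n) G alt x) ⟩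
      ∑ (words (suc n) (pairs xs)) (G ∘ flatten) +
        suc n · ∑ xs (λ y → ∑ (words n (pairs xs)) (λ w → G (x ∷ y ∷ flatten w)))
        ≈⟨ +-cong (∑-alternating (suc n) xs G alt)
             (×-congʳ (suc n) (∑-alternating-odd n xs (λ w → G (x ∷ w)) (alt ∘ there))) ⟩
      suc n ! · ∑ (comb (suc n ℕ.* 2) xs) G + suc n · (n ! · ∑ (comb (suc (n ℕ.* 2)) xs) (λ w → G (x ∷ w)))
        ≈⟨ factorial-step n ⟩
      suc n ! · (∑ (comb (suc (n ℕ.* 2)) xs) (λ w → G (x ∷ w)) + ∑ (comb (suc n ℕ.* 2) xs) G)
        ≈⟨ ×-congʳ (suc n !) (∑-comb (suc (n ℕ.* 2)) x xs G) ⟨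
      suc n ! · ∑ (comb (suc n ℕ.* 2) (x ∷ xs)) G ∎

    -- The unpaired letter `y` is not restricted by any order. The contributions in which `x`
    -- belongs to a pair vanish, by repetition or by cancellation, so `x` is either the unpaired
    -- letter, which leads back to even length, or absent.
    ∑-alternating-odd : ∀ n (xs : List A) (K : Vec A (suc (n ℕ.* 2)) → Carrier) → Alternates K →
      ∑ xs (λ y → ∑ (words n (pairs xs)) (λ w → K (y ∷ flatten w))) ≈ n ! · ∑ (comb (suc (n ℕ.* 2)) xs) K
    ∑-alternating-odd n []       K alt = sym (·-zero (n !) refl)
    ∑-alternating-odd {A = A} n (x ∷ xs) K alt = begin
      ∑ (words n (pairs (x ∷ xs))) (λ w → K (x ∷ flatten w)) +
        ∑ xs (λ y → ∑ (words n (pairs (x ∷ xs))) (λ w → K (y ∷ flatten w)))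
        ≈⟨ +-cong (drop-head n K alt) (drop-tail n K alt) ⟩
      ∑ (words n (pairs xs)) (λ w → K (x ∷ flatten w)) +
        ∑ xs (λ y → ∑ (words n (pairs xs)) (λ w → K (y ∷ flatten w)))
        ≈⟨ +-cong (∑-alternating n xs (λ w → K (x ∷ w)) (alt ∘ there)) (∑-alternating-odd n xs K alt) ⟩
      n ! · ∑ (comb (n ℕ.* 2) xs) (λ w → K (x ∷ w)) + n ! · ∑ (comb (suc (n ℕ.* 2)) xs) K
        ≈⟨ ×-distrib-+ _ _ (n !) ⟨
      n ! · (∑ (comb (n ℕ.* 2) xs) (λ w → K (x ∷ w)) + ∑ (comb (suc (n ℕ.* 2)) xs) K)
        ≈⟨ ×-congʳ (n !) (∑-comb (n ℕ.* 2) x xs K) ⟨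
      n ! · ∑ (comb (suc (n ℕ.* 2)) (x ∷ xs)) K ∎
      where
      insert : ∀ n (K : Vec A (suc (suc n ℕ.* 2)) → Carrier) → Alternates K → ∀ y →
        ∑ (words (suc n) (pairs (x ∷ xs))) (λ w → K (y ∷ flatten w)) ≈
        ∑ (words (suc n) (pairs xs)) (λ w → K (y ∷ flatten w)) +
          suc n · ∑ xs (λ z → ∑ (words n (pairs xs)) (λ w → K (y ∷ x ∷ z ∷ flatten w)))
      insert n K alt y = ∑-words-++ n (x ,_) xs (pairs xs) (λ w → K (y ∷ flatten w))
        (flatten-symmetric (suc n) (λ w → K (y ∷ w)) (alt ∘ there)) (flatten-clash (suc n) (λ w → K (y ∷ w)) (alt ∘ there) x)

      drop-head : ∀ n (K : Vec A (suc (n ℕ.* 2)) → Carrier) → Alternates K →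
        ∑ (words n (pairs (x ∷ xs))) (λ w → K (x ∷ flatten w)) ≈ ∑ (words n (pairs xs)) (λ w → K (x ∷ flatten w))
      drop-head zero    K alt = refl
      drop-head (suc n) K alt = trans (insert n K alt x) (trans
        (+-congˡ (·-zero (suc n) (Sum.fold-ε xs λ z → Sum.fold-ε (words n (pairs xs)) λ w → repeat-zero K alt x _)))
        (+-identityʳ _))

      drop-tail : ∀ n (K : Vec A (suc (n ℕ.* 2)) → Carrier) → Alternates K →
        ∑ xs (λ y → ∑ (words n (pairs (x ∷ xs))) (λ w → K (y ∷ flatten w))) ≈
        ∑ xs (λ y → ∑ (words n (pairs xs)) (λ w → K (y ∷ flatten w)))
      drop-tail zero    K alt = refl
      drop-tail (suc n) K alt = begin
        ∑ xs (λ y → ∑ (words (suc n) (pairs (x ∷ xs))) (λ w → K (y ∷ flatten w)))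
          ≈⟨ trans (Sum.fold-cong xs (insert n K alt)) (Sum.fold-∙ xs _ _) ⟩
        ∑ xs (λ y → ∑ (words (suc n) (pairs xs)) (λ w → K (y ∷ flatten w))) +
          ∑ xs (λ y → suc n · ∑ xs (T y))
          -- In `K (y ∷ x ∷ z ∷ …)` both `y` and `z` run through `xs`, and exchanging them takes
          -- three adjacent swaps.
          ≈⟨ +-congˡ (trans (∑-· (suc n) xs _) (·-zero (suc n) (∑-antisymmetric xs T anti))) ⟩
        ∑ xs (λ y → ∑ (words (suc n) (pairs xs)) (λ w → K (y ∷ flatten w))) + 0#
          ≈⟨ +-identityʳ _ ⟩
        ∑ xs (λ y → ∑ (words (suc n) (pairs xs)) (λ w → K (y ∷ flatten w))) ∎
        where
        T : A → A → Carrier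
        T y z = ∑ (words n (pairs xs)) (λ w → K (y ∷ x ∷ z ∷ flatten w))
        anti : ∀ y z → T y z ≈ - T z y
        anti y z = trans (Sum.fold-cong (words n (pairs xs)) λ w →
          trans (neg-neg (alt here) (alt (there here))) (alt here)) (∑-neg (words n (pairs xs)) _)

  -- Laplace expansion along pairs of rows

  lt : Fin N → Fin N → Carrier
  lt Fin.zero    Fin.zero    = 0#
  lt Fin.zero    (Fin.suc _) = 1#
  lt (Fin.suc _) Fin.zero    = 0#
  lt (Fin.suc i) (Fin.suc j) = lt i j

  lt-total : (i j : Fin N) → i ≡ j ⊎ (lt i j + lt j i ≈ 1#)
  lt-total Fin.zero    Fin.zero    = inj₁ ≡.refl
  lt-total Fin.zero    (Fin.suc _) = inj₂ (+-identityʳ 1#)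
  lt-total (Fin.suc _) Fin.zero    = inj₂ (+-identityˡ 1#)
  lt-total (Fin.suc i) (Fin.suc j) with lt-total i j
  ... | inj₁ i≡j = inj₁ (≡.cong Fin.suc i≡j)
  ... | inj₂ eq  = inj₂ eq

  ∑-lt : ∀ (ys : List (Fin N)) (Φ α : Fin N → Fin N → Carrier) → (∀ u t → Φ u t ≈ - Φ t u) →
    ∑ ys (λ u → ∑ ys (λ t → lt u t * (Φ u t * (α u t - α t u)))) ≈
    ∑ ys (λ u → ∑ ys (λ t → Φ u t * α u t))
  ∑-lt ys Φ α anti = begin
    ∑ ys (λ u → ∑ ys (λ t → lt u t * (Φ u t * (α u t - α t u))))
      ≈⟨ Sum.fold-cong ys (λ u → Sum.fold-cong ys (expand u)) ⟩
    ∑ ys (λ u → ∑ ys (λ t → f u t + g u t))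
      ≈⟨ trans (Sum.fold-cong ys λ u → Sum.fold-∙ ys (f u) (g u)) (Sum.fold-∙ ys _ _) ⟩
    ∑ ys (λ u → ∑ ys (f u)) + ∑ ys (λ u → ∑ ys (g u))
      ≈⟨ +-congˡ (Sum.fold-swap ys ys g) ⟩
    ∑ ys (λ u → ∑ ys (f u)) + ∑ ys (λ u → ∑ ys (λ t → g t u))
      ≈⟨ trans (Sum.fold-cong ys λ u → Sum.fold-∙ ys (f u) (λ t → g t u)) (Sum.fold-∙ ys _ _) ⟨
    ∑ ys (λ u → ∑ ys (λ t → f u t + g t u))
      ≈⟨ Sum.fold-cong ys (λ u → Sum.fold-cong ys (collect u)) ⟩
    ∑ ys (λ u → ∑ ys (λ t → Φ u t * α u t)) ∎
    where
    f g : Fin _ → Fin _ → Carrier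
    f u t = lt u t * (Φ u t * α u t)
    g u t = lt u t * (Φ t u * α t u)
    expand : ∀ u t → lt u t * (Φ u t * (α u t - α t u)) ≈ f u t + g u t
    expand u t = trans (*-congˡ (trans (distribˡ _ _ _) (+-congˡ
      (trans (*-congʳ (anti u t)) (trans (sym (-‿distribˡ-* _ _))
        (trans (-‿cong (sym (-‿distribʳ-* _ _))) (-‿involutive _))))))) (distribˡ _ _ _)
    collect : ∀ u t → f u t + g t u ≈ Φ u t * α u t
    collect u t with lt-total u t
    ... | inj₂ eq = trans (sym (distribʳ _ _ _)) (trans (*-congʳ eq) (*-identityˡ _))
    ... | inj₁ ≡.refl = trans (+-cong zero′ zero′) (trans (+-identityˡ 0#)
                              (sym (trans (*-congʳ Φ≈0) (zeroˡ _))))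
      where
      Φ≈0 : Φ u u ≈ 0#
      Φ≈0 = halve _ (anti u u)
      zero′ : f u u ≈ 0#
      zero′ = trans (*-congˡ (trans (*-congʳ Φ≈0) (zeroˡ _))) (zeroʳ _)

  -- The condition that cuts out `𝔈`, as a factor 0 or 1, so that sums over `𝔈` also extend to all
  -- words.
  ascending : ∀ {n} → Vec (Fin N) (n ℕ.* 2) → Carrier
  ascending {n = zero}  []          = 1#
  ascending {n = suc n} (u ∷ t ∷ w) = lt u t * ascending {n = n} w

  minor : (A → B → Carrier) → A × A → B → B → Carrier
  minor a (x , y) u t = a x u * a y t - a x t * a y u

  minors : (A → B → Carrier) → Vec (A × A) n → Vec B (n ℕ.* 2) → Carrier
  minors a []      []          = 1#
  minors a (p ∷ k) (u ∷ t ∷ w) = minor a p u t * minors a k w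

  -- With an arbitrary alternating `E` in place of `sign`, the induction can fix the two columns of
  -- the first minor; `∑-lt` then lifts the restriction that they ascend.
  laplace : ∀ n (ys : List (Fin N)) (a : A → Fin N → Carrier) (E : Vec (Fin N) (n ℕ.* 2) → Carrier) →
    Alternates E → ∀ (k : Vec (A × A) n) →
    ∑ (words (n ℕ.* 2) ys) (λ w → ascending {n = n} w * (E w * minors a k w)) ≈ transform ys a E (flatten k)
  laplace zero    ys a E alt [] = +-congʳ (*-identityˡ _)
  laplace (suc n) ys a E alt ((x , y) ∷ k) = begin
    ∑ (words (suc n ℕ.* 2) ys) (λ w → ascending {n = suc n} w * (E w * minors a ((x , y) ∷ k) w))
      ≈⟨ trans (∑-words (suc (n ℕ.* 2)) ys _) (Sum.fold-cong ys λ u → ∑-words (n ℕ.* 2) ys _) ⟩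
    ∑ ys (λ u → ∑ ys (λ t → ∑ (words (n ℕ.* 2) ys) (λ w →
      lt u t * ascending {n = n} w * (E (u ∷ t ∷ w) * (minor a (x , y) u t * minors a k w)))))
      ≈⟨ Sum.fold-cong ys (λ u → Sum.fold-cong ys (factor u)) ⟩
    ∑ ys (λ u → ∑ ys (λ t → lt u t * (T u t * (α u t - α t u))))
      ≈⟨ ∑-lt ys T α anti ⟩
    ∑ ys (λ u → ∑ ys (λ t → T u t * α u t))
      ≈⟨ Sum.fold-cong ys (λ u → Sum.fold-cong ys λ t →
           solve 3 (λ a b c → a :* (b :* c) := b :* (c :* a)) refl (T u t) _ _) ⟩
    ∑ ys (λ u → ∑ ys (λ t → a x u * (a y t * T u t)))
      ≈⟨ transform-∷∷ ys a E x y (flatten k) ⟨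
    transform ys a E (flatten ((x , y) ∷ k)) ∎
    where
    T α : Fin _ → Fin _ → Carrier
    T u t = transform ys a (λ w → E (u ∷ t ∷ w)) (flatten k)
    α u t = a x u * a y t
    anti : ∀ u t → T u t ≈ - T t u
    anti u t = trans (transform-cong ys a (λ w → alt here) (flatten k)) (transform-neg ys a _ (flatten k))
    factor : ∀ u t → _ ≈ lt u t * (T u t * (α u t - α t u))
    factor u t = begin
      ∑ (words (n ℕ.* 2) ys) (λ w → lt u t * ascending {n = n} w * (E (u ∷ t ∷ w) * (minor a (x , y) u t * minors a k w)))
        ≈⟨ Sum.fold-cong (words (n ℕ.* 2) ys) (λ w →
             solve 5 (λ l s e b m → l :* s :* (e :* (b :* m)) := l :* (s :* (e :* m) :* b)) refl _ _ _ _ _) ⟩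
      ∑ (words (n ℕ.* 2) ys) (λ w → lt u t * (ascending {n = n} w * (E (u ∷ t ∷ w) * minors a k w) * minor a (x , y) u t))
        ≈⟨ trans (∑-distribˡ (lt u t) (words (n ℕ.* 2) ys) _) (*-congˡ (∑-distribʳ _ (words (n ℕ.* 2) ys) _)) ⟩
      lt u t * (∑ (words (n ℕ.* 2) ys) (λ w → ascending {n = n} w * (E (u ∷ t ∷ w) * minors a k w)) * minor a (x , y) u t)
        ≈⟨ *-congˡ (*-congʳ (laplace n ys a (λ w → E (u ∷ t ∷ w)) (λ s → alt (there (there s))) k)) ⟩
      lt u t * (T u t * minor a (x , y) u t) ∎


  -- From permutations to words

  ∏-filter : {P : Pred A 0ℓ} (P? : Decidable P) (c : Carrier) (xs : List A) →
    c ^ length (filter P? xs) ≈ ∏ xs (λ x → if does (P? x) then c else 1#)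
  ∏-filter P? c []       = refl
  ∏-filter P? c (x ∷ xs) with does (P? x)
  ... | true  = *-congˡ (∏-filter P? c xs)
  ... | false = trans (∏-filter P? c xs) (sym (*-identityˡ _))

  ∑-filter : {P : Pred A 0ℓ} (P? : Decidable P) (xs : List A) {f g : A → Carrier} →
    (∀ x → P x → f x ≈ g x) → (∀ x → ¬ P x → g x ≈ 0#) → ∑ (filter P? xs) f ≈ ∑ xs g
  ∑-filter P? []       f≈g g≈0 = refl
  ∑-filter P? (x ∷ xs) f≈g g≈0 with P? x
  ... | yes p = +-cong (f≈g x p) (∑-filter P? xs f≈g g≈0)
  ... | no ¬p = trans (∑-filter P? xs f≈g g≈0) (sym (trans (+-congʳ (g≈0 x ¬p)) (+-identityˡ _)))

  inversionSign : Fin N → Fin N → Carrier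
  inversionSign x y = if does (y Fin.<? x) then - 1# else 1#

  inversionSign≈sg : (x y : Fin N) → x ≢ y → inversionSign x y ≈ sg x y
  inversionSign≈sg Fin.zero    Fin.zero    x≢y = contradiction ≡.refl x≢y
  inversionSign≈sg Fin.zero    (Fin.suc _) x≢y = refl
  inversionSign≈sg (Fin.suc _) Fin.zero    x≢y = refl
  inversionSign≈sg (Fin.suc x) (Fin.suc y) x≢y = inversionSign≈sg x y (x≢y ∘ ≡.cong Fin.suc)

  sg-diagonal : (x : Fin N) → sg x x ≈ 0#
  sg-diagonal x = halve _ (sg-anti x x)

  rowSign-inversions : (x : Fin N) (w : Vec (Fin N) n) → All (x ≢_) (toList w) →
    ∏ (allFin n) (λ j → inversionSign x (lookup w j)) ≈ rowSign x w
  rowSign-inversions x []      []           = refl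
  rowSign-inversions x (y ∷ w) (x≢y ∷ x∉w) = trans
    (reflexive (Prod.fold-suc _ λ j → inversionSign x (lookup (y ∷ w) j)))
    (*-cong (inversionSign≈sg x y x≢y) (rowSign-inversions x w x∉w))

  -- Row 0 of the double product gives `rowSign x w`. In every row the entry in column 0 is 1,
  -- because i < 0 fails, so the later rows reproduce the product for `w`.
  sign-inversions : (w : Vec (Fin N) n) → Unique (toList w) →
    ∏ (allFin n) (λ i → ∏ (allFin n) λ j →
      if does (i Fin.<? j) ∧ does (lookup w j Fin.<? lookup w i) then - 1# else 1#) ≈ sign w
  sign-inversions []      []          = refl
  sign-inversions {n = suc n} (x ∷ w) (x∉w ∷ unique) = trans
    (reflexive (Prod.fold-suc n λ i → ∏ (allFin (suc n)) (b i)))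
    (*-cong
      (trans (reflexive (Prod.fold-suc n (b Fin.zero))) (trans (*-identityˡ _) (rowSign-inversions x w x∉w)))
      (trans (Prod.fold-cong (allFin n) λ i →
               trans (reflexive (Prod.fold-suc n (b (Fin.suc i)))) (*-identityˡ _))
             (sign-inversions w unique)))
    where
    b : Fin (suc n) → Fin (suc n) → Carrier
    b i j = if does (i Fin.<? j) ∧ does (lookup (x ∷ w) j Fin.<? lookup (x ∷ w) i) then - 1# else 1#

  sgnᴿ : Vec (Fin n) n → Carrier
  sgnᴿ σ = (- 1#) ^ inversions σ

  sgnᴿ≈sign : (σ : Vec (Fin n) n) → Unique (toList σ) → sgnᴿ σ ≈ sign σ
  sgnᴿ≈sign {n} σ unique = trans (∏-filter _ (- 1#) (cartesianProduct (allFin n) (allFin n)))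
    (trans (Prod.fold-product _,_ (allFin n) (allFin n) _) (sign-inversions σ unique))

  rowSign-zero : (x : Fin N) (w : Vec (Fin N) n) → x Vec.∈ w → rowSign x w ≈ 0#
  rowSign-zero x (.x ∷ w) (here ≡.refl) = trans (*-congʳ (sg-diagonal x)) (zeroˡ _)
  rowSign-zero x (y ∷ w)  (there x∈w)   = trans (*-congˡ (rowSign-zero x w x∈w)) (zeroʳ _)

  distinct? : (x : Fin N) (w : Vec (Fin N) n) → All (x ≢_) (toList w) ⊎ x Vec.∈ w
  distinct? x []      = inj₁ []
  distinct? x (y ∷ w) with x Fin.≟ y | distinct? x w
  ... | yes x≡y | _          = inj₂ (here x≡y)
  ... | no  x≢y | inj₁ x∉w = inj₁ (x≢y ∷ x∉w)
  ... | no  x≢y | inj₂ x∈w = inj₂ (there x∈w)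

  sign-zero : (w : Vec (Fin N) n) → ¬ Unique (toList w) → sign w ≈ 0#
  sign-zero []      ¬unique = contradiction [] ¬unique
  sign-zero (x ∷ w) ¬unique with distinct? x w
  ... | inj₁ x∉w = trans (*-congˡ (sign-zero w λ unique → ¬unique (x∉w ∷ unique))) (zeroʳ _)
  ... | inj₂ x∈w = trans (*-congʳ (rowSign-zero x w x∈w)) (zeroˡ _)

  ∑-𝔖 : ∀ n (f : Vec (Fin n) n → Carrier) →
    ∑ (𝔖 n) (λ σ → sgnᴿ σ * f σ) ≈ ∑ (words n (allFin n)) (λ w → sign w * f w)
  ∑-𝔖 n f = ∑-filter _ (words n (allFin n))
    (λ σ unique → *-congʳ (sgnᴿ≈sign σ unique))
    (λ w ¬unique → trans (*-congʳ (sign-zero w ¬unique)) (zeroˡ _))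

  Ascends : ∀ n → Vec (Fin N) (n ℕ.* 2) → Set
  Ascends n w = (i : Fin n) → lookup w (odd i) Fin.< lookup w (even i)

  lt-yes : {i j : Fin N} → i Fin.< j → lt i j ≈ 1#
  lt-yes {i = Fin.zero}  {Fin.suc _} _           = refl
  lt-yes {i = Fin.suc i} {Fin.suc j} (ℕ.s≤s i<j) = lt-yes i<j

  lt-no : (i j : Fin N) → ¬ i Fin.< j → lt i j ≈ 0#
  lt-no Fin.zero    Fin.zero    _   = refl
  lt-no Fin.zero    (Fin.suc _) i≮j = contradiction (ℕ.s≤s ℕ.z≤n) i≮j
  lt-no (Fin.suc _) Fin.zero    _   = refl
  lt-no (Fin.suc i) (Fin.suc j) i≮j = lt-no i j (i≮j ∘ ℕ.s≤s)

  ascending-yes : ∀ n (w : Vec (Fin N) (n ℕ.* 2)) → Ascends n w → ascending {n = n} w ≈ 1#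
  ascending-yes zero    []          asc = refl
  ascending-yes (suc n) (u ∷ t ∷ w) asc = trans
    (*-cong (lt-yes (asc Fin.zero)) (ascending-yes n w (asc ∘ Fin.suc))) (*-identityˡ 1#)

  ascending-no : ∀ n (w : Vec (Fin N) (n ℕ.* 2)) → ¬ Ascends n w → ascending {n = n} w ≈ 0#
  ascending-no zero    []          ¬asc = contradiction (λ ()) ¬asc
  ascending-no (suc n) (u ∷ t ∷ w) ¬asc with u Fin.<? t
  ... | no u≮t  = trans (*-congʳ (lt-no u t u≮t)) (zeroˡ _)
  ... | yes u<t = trans (*-congˡ (ascending-no n w λ asc →
    ¬asc λ { Fin.zero → u<t ; (Fin.suc i) → asc i })) (zeroʳ _)

  ∑-𝔈 : ∀ n (f : Vec (Fin (n ℕ.* 2)) (n ℕ.* 2) → Carrier) →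
    ∑ (𝔈 n) (λ σ → sgnᴿ σ * f σ) ≈
    ∑ (words (n ℕ.* 2) (allFin (n ℕ.* 2))) (λ w → ascending {n = n} w * (sign w * f w))
  ∑-𝔈 n f = trans
    (∑-filter _ (𝔖 (n ℕ.* 2))
      {g = λ σ → sgnᴿ σ * (ascending {n = n} σ * f σ)}
      (λ σ asc → *-congˡ (sym (trans (*-congʳ (ascending-yes n σ asc)) (*-identityˡ _))))
      (λ σ ¬asc → trans (*-congˡ (trans (*-congʳ (ascending-no n σ ¬asc)) (zeroˡ _))) (zeroʳ _)))
    (trans (∑-𝔖 (n ℕ.* 2) λ σ → ascending {n = n} σ * f σ)
      (Sum.fold-cong (words (n ℕ.* 2) (allFin (n ℕ.* 2))) λ w →
        solve 3 (λ a b c → a :* (b :* c) := b :* (a :* c)) refl _ _ _))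

  -- Reversal of columns

  -- (-1)^(n(n-1)/2), the sign of the reversal of n letters.
  τ : ℕ → Carrier
  τ zero    = 1#
  τ (suc n) = (- 1#) ^ n * τ n

  -1*-1 : - 1# * - 1# ≈ 1#
  -1*-1 = trans (sym (-‿distribˡ-* _ _)) (trans (-‿cong (*-identityˡ _)) (-‿involutive 1#))

  square-one : ∀ {x y} → x * x ≈ 1# → y * y ≈ 1# → (x * y) * (x * y) ≈ 1#
  square-one xx yy = trans (solve 2 (λ x y → x :* y :* (x :* y) := x :* x :* (y :* y)) refl _ _)
    (trans (*-cong xx yy) (*-identityˡ 1#))

  -1^-square : ∀ n → (- 1#) ^ n * (- 1#) ^ n ≈ 1#
  -1^-square zero    = *-identityˡ 1#
  -1^-square (suc n) = square-one -1*-1 (-1^-square n)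

  τ-square : ∀ n → τ n * τ n ≈ 1#
  τ-square zero    = *-identityˡ 1#
  τ-square (suc n) = square-one (-1^-square n) (τ-square n)

  -- The exponent 2n(2n - 1)/2 = n(2n - 1) has the parity of n.
  τ-double : ∀ n → τ (n ℕ.* 2) ≈ (- 1#) ^ n
  τ-double zero    = refl
  τ-double (suc n) = begin
    - 1# * (- 1#) ^ (n ℕ.* 2) * ((- 1#) ^ (n ℕ.* 2) * τ (n ℕ.* 2))
      ≈⟨ solve 3 (λ a b c → a :* b :* (b :* c) := b :* b :* (a :* c)) refl _ _ _ ⟩
    (- 1#) ^ (n ℕ.* 2) * (- 1#) ^ (n ℕ.* 2) * (- 1# * τ (n ℕ.* 2))
      ≈⟨ *-cong (-1^-square (n ℕ.* 2)) (*-congˡ (τ-double n)) ⟩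
    1# * (- 1# * (- 1#) ^ n)
      ≈⟨ *-identityˡ _ ⟩
    - 1# * (- 1#) ^ n ∎

  sg-yes : (i j : Fin N) → i Fin.< j → sg i j ≈ 1#
  sg-yes Fin.zero    (Fin.suc _) _           = refl
  sg-yes (Fin.suc i) (Fin.suc j) (ℕ.s≤s i<j) = sg-yes i j i<j

  opposite-< : {i j : Fin N} → i Fin.< j → opposite j Fin.< opposite i
  opposite-< {i = i} {j} i<j rewrite Fin.opposite-prop i | Fin.opposite-prop j =
    ℕ.∸-monoʳ-< (ℕ.s≤s i<j) (Fin.toℕ<n j)

  sg-opposite : (i j : Fin N) → sg (opposite i) (opposite j) ≈ - sg i j
  sg-opposite i j with Fin.<-cmp i j
  ... | tri< i<j _ _ = trans (sg-anti (opposite i) (opposite j))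
    (-‿cong (trans (sg-yes (opposite j) (opposite i) (opposite-< i<j)) (sym (sg-yes i j i<j))))
  ... | tri≈ _ ≡.refl _ =
    trans (sg-diagonal (opposite i)) (sym (trans (-‿cong (sg-diagonal i)) -0#≈0#))
  ... | tri> _ _ j<i = trans (sg-yes (opposite i) (opposite j) (opposite-< j<i))
    (trans (sym (sg-yes j i j<i)) (sg-anti j i))

  rowSign-opposite : (x : Fin N) (w : Vec (Fin N) n) →
    rowSign (opposite x) (Vec.map opposite w) ≈ (- 1#) ^ n * rowSign x w
  rowSign-opposite x []      = sym (*-identityˡ 1#)
  rowSign-opposite x (y ∷ w) = trans
    (*-cong (trans (sg-opposite x y) (neg≈-1* _)) (rowSign-opposite x w))
    (solve 4 (λ a b c d → a :* b :* (c :* d) := a :* c :* (b :* d)) refl _ _ _ _)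

  sign-opposite : (w : Vec (Fin N) n) → sign (Vec.map opposite w) ≈ τ n * sign w
  sign-opposite []      = sym (*-identityˡ 1#)
  sign-opposite (x ∷ w) = trans (*-cong (rowSign-opposite x w) (sign-opposite w))
    (solve 4 (λ a b c d → a :* b :* (c :* d) := a :* c :* (b :* d)) refl _ _ _ _)

  ∑-words-map : ∀ n (g : A → B) xs ys → (∀ f → ∑ xs (f ∘ g) ≈ ∑ ys f) →
    (f : Vec B n → Carrier) → ∑ (words n xs) (f ∘ Vec.map g) ≈ ∑ (words n ys) f
  ∑-words-map zero    g xs ys eq f = refl
  ∑-words-map (suc n) g xs ys eq f = trans (∑-words n xs _) (trans
    (Sum.fold-cong xs λ x → ∑-words-map n g xs ys eq (λ w → f (g x ∷ w)))
    (trans (eq (λ y → ∑ (words n ys) (λ w → f (y ∷ w)))) (sym (∑-words n ys f))))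

  alternates-∷ʳ : (F : Vec A (suc n) → Carrier) → Alternates F → ∀ c x →
    F (c Vec.∷ʳ x) ≈ (- 1#) ^ n * F (x ∷ c)
  alternates-∷ʳ F alt []      x = sym (*-identityˡ _)
  alternates-∷ʳ {n = suc n} F alt (y ∷ c) x = begin
    F (y ∷ (c Vec.∷ʳ x))              ≈⟨ alternates-∷ʳ (λ w → F (y ∷ w)) (alt ∘ there) c x ⟩
    (- 1#) ^ n * F (y ∷ x ∷ c)    ≈⟨ *-congˡ (trans (alt here) (neg≈-1* _)) ⟩
    (- 1#) ^ n * (- 1# * F (x ∷ y ∷ c)) ≈⟨ solve 3 (λ a b c → a :* (b :* c) := b :* a :* c) refl _ _ _ ⟩
    (- 1#) ^ suc n * F (x ∷ y ∷ c) ∎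

  ∑-words-restrict : ∀ m N (F : Vec (Fin (suc N)) m → Carrier) → (∀ w → Fin.zero Vec.∈ w → F w ≈ 0#) →
    ∑ (words m (allFin (suc N))) F ≈ ∑ (words m (allFin N)) (F ∘ Vec.map Fin.suc)
  ∑-words-restrict zero    N F kill = refl
  ∑-words-restrict (suc m) N F kill = begin
    ∑ (words (suc m) (allFin (suc N))) F
      ≈⟨ ∑-words m (allFin (suc N)) F ⟩
    ∑ (allFin (suc N)) (λ u → ∑ (words m (allFin (suc N))) (λ w → F (u ∷ w)))
      ≈⟨ reflexive (Sum.fold-suc N _) ⟩
    ∑ (words m (allFin (suc N))) (λ w → F (Fin.zero ∷ w)) +
      ∑ (allFin N) (λ u → ∑ (words m (allFin (suc N))) (λ w → F (Fin.suc u ∷ w)))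
      ≈⟨ trans (+-congʳ (Sum.fold-ε (words m (allFin (suc N))) λ w → kill _ (here ≡.refl))) (+-identityˡ _) ⟩
    ∑ (allFin N) (λ u → ∑ (words m (allFin (suc N))) (λ w → F (Fin.suc u ∷ w)))
      ≈⟨ Sum.fold-cong (allFin N) (λ u →
           ∑-words-restrict m N (λ w → F (Fin.suc u ∷ w)) (λ w 0∈w → kill _ (there 0∈w))) ⟩
    ∑ (allFin N) (λ u → ∑ (words m (allFin N)) (λ w → F (Fin.suc u ∷ Vec.map Fin.suc w)))
      ≈⟨ ∑-words m (allFin N) _ ⟨
    ∑ (words (suc m) (allFin N)) (F ∘ Vec.map Fin.suc) ∎

  rowSign-first : (w : Vec (Fin N) n) → rowSign Fin.zero (Vec.map Fin.suc w) ≈ 1#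
  rowSign-first []      = refl
  rowSign-first (x ∷ w) = trans (*-identityˡ _) (rowSign-first w)

  rowSign-suc : (x : Fin N) (w : Vec (Fin N) n) → rowSign (Fin.suc x) (Vec.map Fin.suc w) ≈ rowSign x w
  rowSign-suc x []      = refl
  rowSign-suc x (y ∷ w) = *-congˡ (rowSign-suc x w)

  sign-suc : (w : Vec (Fin N) n) → sign (Vec.map Fin.suc w) ≈ sign w
  sign-suc []      = refl
  sign-suc (x ∷ w) = *-cong (rowSign-suc x w) (sign-suc w)

  -- From determinants of complete functions to Schur functions

  module Complete (h : ℤ → Carrier) (h-zero : h (+ 0) ≈ 1#) (h-neg : ∀ k → h -[1+ k ] ≈ 0#) where

    entry : ℕ → Fin n → Carrier
    entry k j = h (+ k ℤ.- pos j)

    -- det (h_{kᵢ - j}), 1 ≤ i, j ≤ n, as a function of k.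
    D : ∀ n → Vec ℕ n → Carrier
    D n = transform (allFin n) entry sign

    D-alternates : ∀ n → Alternates (D n)
    D-alternates n = transform-alternates (allFin n) entry sign sign-alternates

    pairing-suc : (c : Vec ℕ m) (w : Vec (Fin N) m) →
      pairing entry (Vec.map suc c) (Vec.map Fin.suc w) ≈ pairing entry c w
    pairing-suc []      []      = refl
    pairing-suc (k ∷ c) (j ∷ w) = *-cong (reflexive (≡.cong h shift)) (pairing-suc c w)
      where
      shift : + suc k ℤ.- + suc (suc (toℕ j)) ≡ + k ℤ.- + suc (toℕ j)
      shift = ≡.trans (ℤ.m-n≡m⊖n (suc k) (suc (suc (toℕ j))))
        (≡.trans (ℤ.[1+m]⊖[1+n]≡m⊖n k (suc (toℕ j))) (≡.sym (ℤ.m-n≡m⊖n k (suc (toℕ j)))))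

    -- The row of the letter 1 is (h_0, h_(-1), ...) = (1, 0, ..., 0). In the minor that remains,
    -- letters and column numbers are both one too large, and the subscripts depend on their
    -- difference only.
    D-first : ∀ n c → D (suc n) (1 ∷ Vec.map suc c) ≈ D n c
    D-first n c = begin
      D (suc n) (1 ∷ Vec.map suc c)
        ≈⟨ transform-∷ (allFin (suc n)) entry sign 1 (Vec.map suc c) ⟩
      ∑ (allFin (suc n)) (λ u → entry 1 u * T u)
        ≈⟨ reflexive (Sum.fold-suc n _) ⟩
      h (+ 0) * T Fin.zero + ∑ (allFin n) (λ u → h -[1+ toℕ u ] * T (Fin.suc u))
        ≈⟨ +-cong (trans (*-congʳ h-zero) (*-identityˡ _))
             (Sum.fold-ε (allFin n) λ u → trans (*-congʳ (h-neg (toℕ u))) (zeroˡ _)) ⟩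
      T Fin.zero + 0#
        ≈⟨ +-identityʳ _ ⟩
      T Fin.zero
        ≈⟨ ∑-words-restrict n n _ (λ w 0∈w → trans
             (*-congʳ (trans (*-congʳ (rowSign-zero Fin.zero w 0∈w)) (zeroˡ _))) (zeroˡ _)) ⟩
      ∑ (words n (allFin n)) (λ w → rowSign Fin.zero (Vec.map Fin.suc w) * sign (Vec.map Fin.suc w) *
        pairing entry (Vec.map suc c) (Vec.map Fin.suc w))
        ≈⟨ Sum.fold-cong (words n (allFin n)) (λ w →
             *-cong (trans (*-cong (rowSign-first w) (sign-suc w)) (*-identityˡ _)) (pairing-suc c w)) ⟩
      D n c ∎
      where
      T : Fin (suc n) → Carrier
      T u = transform (allFin (suc n)) entry (λ w → sign (u ∷ w)) (Vec.map suc c)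

    -- The determinant defining `schur`, with the rational scalar signs replaced by ring elements.
    schurᴿ : List ℕ → Carrier
    schurᴿ xs = ∑ (𝔖 (length xs)) (λ σ → sgnᴿ σ * ∏ (allFin (length xs)) λ i →
      h (+ List.lookup xs i ℤ.- + toℕ i ℤ.+ + toℕ (lookup σ i)))

    D-length : ∀ xs → D (length xs) (strict (length xs) xs) ≈ τ (length xs) * schurᴿ xs
    D-length xs = begin
      ∑ ws (λ w → sign w * pairing entry c w)
        ≈⟨ ∑-words-map ℓ opposite (allFin ℓ) (allFin ℓ) (Sum.fold-opposite ℓ) _ ⟨
      ∑ ws (λ w → sign (Vec.map opposite w) * pairing entry c (Vec.map opposite w))
        ≈⟨ Sum.fold-cong ws (λ w → trans (*-cong (sign-opposite w) (product w)) (*-assoc _ _ _)) ⟩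
      ∑ ws (λ w → τ ℓ * (sign w * term w))
        ≈⟨ ∑-distribˡ (τ ℓ) ws _ ⟩
      τ ℓ * ∑ ws (λ w → sign w * term w)
        ≈⟨ *-congˡ (∑-𝔖 ℓ term) ⟨
      τ ℓ * schurᴿ xs ∎
      where
      ℓ : ℕ
      ℓ = length xs
      c : Vec ℕ ℓ
      c = strict ℓ xs
      ws : List (Vec (Fin ℓ) ℓ)
      ws = words ℓ (allFin ℓ)
      term : Vec (Fin ℓ) ℓ → Carrier
      term w = ∏ (allFin ℓ) λ i → h (+ List.lookup xs i ℤ.- + toℕ i ℤ.+ + toℕ (lookup w i))
      product : ∀ w → pairing entry c (Vec.map opposite w) ≈ term w
      product w = trans (sym (∏-pairing entry c (Vec.map opposite w)))
        (Prod.fold-cong (allFin ℓ) λ i → reflexive (≡.cong h (≡.trans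
          (≡.cong (λ j → + lookup c i ℤ.- pos j) (Vec.lookup-map i opposite w))
          (reindex (lookup c i) (toℕ i) (List.lookup xs i) (suc (toℕ (opposite (lookup w i)))) (toℕ (lookup w i))
            (lookup-strict xs i) (opposite-+ (lookup w i))))))

    -- A zero part appends the row of the letter 1. Bringing it to the front past `n` rows costs
    -- (-1)^n, exactly the step from `τ n` to `τ (suc n)`, and `D-first` then removes it.
    D-strict : ∀ n xs → length xs ℕ.≤ n → D n (strict n xs) ≈ τ n * schurᴿ xs
    D-strict n xs len = go (ℕ.≤⇒≤′ len)
      where
      go : ∀ {n} → length xs ℕ.≤′ n → D n (strict n xs) ≈ τ n * schurᴿ xs
      go (ℕ.≤′-reflexive ≡.refl) = D-length xs
      go (ℕ.≤′-step {n} len) = begin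
        D (suc n) (strict (suc n) xs)
          ≡⟨ ≡.cong (D (suc n)) (strict-suc n xs (ℕ.≤′⇒≤ len)) ⟩
        D (suc n) (Vec.map suc (strict n xs) Vec.∷ʳ 1)
          ≈⟨ alternates-∷ʳ (D (suc n)) (D-alternates (suc n)) (Vec.map suc (strict n xs)) 1 ⟩
        (- 1#) ^ n * D (suc n) (1 ∷ Vec.map suc (strict n xs))
          ≈⟨ *-congˡ (trans (D-first n (strict n xs)) (go len)) ⟩
        (- 1#) ^ n * (τ n * schurᴿ xs)
          ≈⟨ *-assoc _ _ _ ⟨
        τ (suc n) * schurᴿ xs ∎


  -- Expansion of hyperdeterminants and hyperpfaffians

  ∑-cong-All : {xs : List A} {f g : A → Carrier} → All (λ x → f x ≈ g x) xs → ∑ xs f ≈ ∑ xs g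
  ∑-cong-All []       = refl
  ∑-cong-All (p ∷ ps) = +-cong p (∑-cong-All ps)

  ∏-zero : ∀ {M} (s : Fin M) (f : Fin M → Carrier) → f s ≈ 0# → ∏ (allFin M) f ≈ 0#
  ∏-zero {suc M} Fin.zero    f eq = trans (reflexive (Prod.fold-suc M f)) (trans (*-congʳ eq) (zeroˡ _))
  ∏-zero {suc M} (Fin.suc s) f eq = trans (reflexive (Prod.fold-suc M f))
    (trans (*-congˡ (∏-zero s (f ∘ Fin.suc) eq)) (zeroʳ _))

  ∏-const : ∀ M c → ∏ (allFin M) (λ _ → c) ≈ c ^ M
  ∏-const zero    c = refl
  ∏-const (suc M) c = trans (reflexive (Prod.fold-suc M λ _ → c)) (*-congˡ (∏-const M c))

  ∏-scale : ∀ M c (f : Fin M → Carrier) → ∏ (allFin M) (λ s → c * f s) ≈ c ^ M * ∏ (allFin M) f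
  ∏-scale M c f = trans (Prod.fold-∙ (allFin M) (λ _ → c) f) (*-congʳ (∏-const M c))

  -- One interchange serves both cases: `S` is `𝔖 n` or `𝔈 n`, `χ` is the sign, and `ks` records the
  -- summand chosen in each of the `n` array entries. For fixed `ks` the sum factors over the
  -- alphabets `s`.
  expand : ∀ M n (S : List A) (χ : A → Carrier) (K : List B) (g : Fin M → B → Fin n → A → Carrier) →
    ∑ (words M S) (λ ys → ∏ (allFin M) (λ s → χ (lookup ys s)) *
      ∏ (allFin n) λ i → ∑ K λ k → ∏ (allFin M) λ s → g s k i (lookup ys s)) ≈
    ∑ (words n K) (λ ks → ∏ (allFin M) λ s → ∑ S λ y → χ y * ∏ (allFin n) λ i → g s (lookup ks i) i y)
  expand M n S χ K g = begin
    ∑ (words M S) (λ ys → ∏ (allFin M) (λ s → χ (lookup ys s)) *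
      ∏ (allFin n) λ i → ∑ K λ k → ∏ (allFin M) λ s → g s k i (lookup ys s))
      ≈⟨ Sum.fold-cong (words M S) (λ ys → trans
           (*-congˡ (∏∑ n K λ i k → ∏ (allFin M) λ s → g s k i (lookup ys s)))
           (sym (∑-distribˡ _ (words n K) _))) ⟩
    ∑ (words M S) (λ ys → ∑ (words n K) λ ks → ∏ (allFin M) (λ s → χ (lookup ys s)) *
      ∏ (allFin n) λ i → ∏ (allFin M) λ s → g s (lookup ks i) i (lookup ys s))
      ≈⟨ Sum.fold-cong (words M S) (λ ys → Sum.fold-cong (words n K) λ ks → trans
           (*-congˡ (Prod.fold-swap (allFin n) (allFin M) λ i s → g s (lookup ks i) i (lookup ys s)))
           (sym (Prod.fold-∙ (allFin M) _ _))) ⟩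
    ∑ (words M S) (λ ys → ∑ (words n K) λ ks → ∏ (allFin M) λ s →
      χ (lookup ys s) * ∏ (allFin n) λ i → g s (lookup ks i) i (lookup ys s))
      ≈⟨ Sum.fold-swap (words M S) (words n K) _ ⟩
    ∑ (words n K) (λ ks → ∑ (words M S) λ ys → ∏ (allFin M) λ s →
      χ (lookup ys s) * ∏ (allFin n) λ i → g s (lookup ks i) i (lookup ys s))
      ≈⟨ Sum.fold-cong (words n K) (λ ks →
           ∏∑ M S λ s y → χ y * ∏ (allFin n) λ i → g s (lookup ks i) i y) ⟨
    ∑ (words n K) (λ ks → ∏ (allFin M) λ s → ∑ S λ y → χ y * ∏ (allFin n) λ i → g s (lookup ks i) i y) ∎

  ∏-minors : ∀ (a : A → B → Carrier) (k : Vec (A × A) n) w →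
    ∏ (allFin n) (λ i → minor a (lookup k i) (lookup w (odd i)) (lookup w (even i))) ≈ minors a k w
  ∏-minors a []      []          = refl
  ∏-minors {n = suc n} a (p ∷ k) (u ∷ t ∷ w) = trans
    (reflexive (Prod.fold-suc n λ i →
      minor a (lookup (p ∷ k) i) (lookup (u ∷ t ∷ w) (odd i)) (lookup (u ∷ t ∷ w) (even i))))
    (*-congˡ (∏-minors a k w))

  -- `s₀` provides an alphabet, so that a product over all alphabets vanishes once the factor of
  -- `s₀` does; an empty product would be 1.
  module Families {M : ℕ} (s₀ : Fin M) (h : Fin M → ℤ → Carrier)
    (h-zero : ∀ s → h s (+ 0) ≈ 1#) (h-neg : ∀ s k → h s -[1+ k ] ≈ 0#) where

    module H (s : Fin M) = Complete (h s) (h-zero s) (h-neg s)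

    DD : ∀ n → Vec ℕ n → Carrier
    DD n c = ∏ (allFin M) λ s → H.D s n c

    DD-swap : ∀ n {v w} → Swap v w → DD n v ≈ (- 1#) ^ M * DD n w
    DD-swap n {v} {w} sw = trans
      (Prod.fold-cong (allFin M) λ s → trans (H.D-alternates s n sw) (neg≈-1* _))
      (∏-scale M (- 1#) λ s → H.D s n w)

    DD-clash : ∀ n x {v : Vec ℕ n} → Clash {I = ⊤} (λ _ → x) v → DD n v ≈ 0#
    DD-clash n@(suc (suc _)) x (clash {w = w}) =
      ∏-zero s₀ (λ s → H.D s n (x ∷ x ∷ w)) (repeat-zero (H.D s₀ n) (H.D-alternates s₀ n) x w)

    DD-down : ∀ n d → ∑ (comb n (down (n ℕ.+ d))) (DD n) ≈
      τ n ^ M * ∑ (shapes n d) (λ xs → ∏ (allFin M) λ s → H.schurᴿ s xs)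
    DD-down n d = begin
      ∑ (comb n (down (n ℕ.+ d))) (DD n)
        ≡⟨ ≡.cong (λ cs → ∑ cs (DD n)) (comb-down n d) ⟩
      ∑ (List.map (strict n) (shapes n d)) (DD n)
        ≡⟨ Sum.fold-map (strict n) (shapes n d) (DD n) ⟩
      ∑ (shapes n d) (λ xs → DD n (strict n xs))
        ≈⟨ ∑-cong-All (All.map (λ {xs} (_ , _ , len) → trans
             (Prod.fold-cong (allFin M) λ s → H.D-strict s n xs len)
             (∏-scale M (τ n) λ s → H.schurᴿ s xs)) (shapes-sound n d)) ⟩
      ∑ (shapes n d) (λ xs → τ n ^ M * ∏ (allFin M) λ s → H.schurᴿ s xs)
        ≈⟨ ∑-distribˡ (τ n ^ M) (shapes n d) _ ⟩
      τ n ^ M * ∑ (shapes n d) (λ xs → ∏ (allFin M) λ s → H.schurᴿ s xs) ∎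

    -- The parity of `M` enters through `ev`, applied to two square roots of one: at -1 it makes
    -- `DD n` symmetric, at `τ n` it removes the reversal sign.
    det-expansion : (∀ x → x * x ≈ 1# → x ^ M ≈ 1#) → ∀ n d →
      ∑ (words M (𝔖 n)) (λ σs → ∏ (allFin M) (λ s → sgnᴿ (lookup σs s)) *
        ∏ (allFin n) λ i → ∑ (down (n ℕ.+ d)) λ k → ∏ (allFin M) λ s →
          h s (+ k ℤ.- pos (lookup (lookup σs s) i))) ≈
      n ! · ∑ (shapes n d) (λ xs → ∏ (allFin M) λ s → H.schurᴿ s xs)
    det-expansion ev n d = begin
      _
        ≈⟨ expand M n (𝔖 n) sgnᴿ (down (n ℕ.+ d)) (λ s k i σ → h s (+ k ℤ.- pos (lookup σ i))) ⟩
      ∑ (words n (down (n ℕ.+ d))) (λ ks → ∏ (allFin M) λ s → ∑ (𝔖 n) λ σ →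
        sgnᴿ σ * ∏ (allFin n) λ i → h s (+ lookup ks i ℤ.- pos (lookup σ i)))
        ≈⟨ Sum.fold-cong (words n (down (n ℕ.+ d))) (λ ks → Prod.fold-cong (allFin M) λ s → trans
             (∑-𝔖 n _) (Sum.fold-cong (words n (allFin n)) λ w → *-congˡ (∏-pairing (H.entry s) ks w))) ⟩
      ∑ (words n (down (n ℕ.+ d))) (DD n)
        ≈⟨ ∑-symmetric n (down (n ℕ.+ d)) (DD n)
             (λ sw → trans (DD-swap n sw) (trans (*-congʳ (ev (- 1#) -1*-1)) (*-identityˡ _)))
             (DD-clash n) ⟩
      n ! · ∑ (comb n (down (n ℕ.+ d))) (DD n)
        ≈⟨ ×-congʳ (n !) (trans (DD-down n d) (trans (*-congʳ (ev (τ n) (τ-square n))) (*-identityˡ _))) ⟩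
      n ! · ∑ (shapes n d) (λ xs → ∏ (allFin M) λ s → H.schurᴿ s xs) ∎

    -- Here `od` keeps one copy of each sign: `DD` alternates, and τ (2n) = (-1)^n stays in the
    -- result.
    pf-expansion : (∀ x → x * x ≈ 1# → x ^ M ≈ x) → ∀ n d →
      ∑ (words M (𝔈 n)) (λ σs → ∏ (allFin M) (λ s → sgnᴿ (lookup σs s)) *
        ∏ (allFin n) λ i → ∑ (pairs (down (n ℕ.* 2 ℕ.+ d))) λ p → ∏ (allFin M) λ s →
          minor (H.entry s) p (lookup (lookup σs s) (odd i)) (lookup (lookup σs s) (even i))) ≈
      n ! · ((- 1#) ^ n * ∑ (shapes (n ℕ.* 2) d) (λ xs → ∏ (allFin M) λ s → H.schurᴿ s xs))
    pf-expansion od n d = begin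
      _
        ≈⟨ expand M n (𝔈 n) sgnᴿ K (λ s p i σ → minor (H.entry s) p (lookup σ (odd i)) (lookup σ (even i))) ⟩
      ∑ (words n K) (λ ks → ∏ (allFin M) λ s → ∑ (𝔈 n) λ σ →
        sgnᴿ σ * ∏ (allFin n) λ i → minor (H.entry s) (lookup ks i) (lookup σ (odd i)) (lookup σ (even i)))
        ≈⟨ Sum.fold-cong (words n K) (λ ks → Prod.fold-cong (allFin M) λ s → trans (∑-𝔈 n _) (trans
             (Sum.fold-cong (words 2n (allFin 2n)) λ w → *-congˡ (*-congˡ (∏-minors (H.entry s) ks w)))
             (laplace n (allFin 2n) (H.entry s) sign sign-alternates ks))) ⟩
      ∑ (words n K) (λ ks → DD 2n (flatten ks))
        ≈⟨ ∑-alternating n (down (2n ℕ.+ d)) (DD 2n) (λ sw → trans (DD-swap 2n sw)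
             (trans (*-congʳ (od (- 1#) -1*-1)) (sym (neg≈-1* _)))) ⟩
      n ! · ∑ (comb 2n (down (2n ℕ.+ d))) (DD 2n)
        ≈⟨ ×-congʳ (n !) (trans (DD-down 2n d) (*-congʳ (trans (od (τ 2n) (τ-square 2n)) (τ-double n)))) ⟩
      n ! · ((- 1#) ^ n * ∑ (shapes 2n d) (λ xs → ∏ (allFin M) λ s → H.schurᴿ s xs)) ∎
      where
      2n : ℕ
      2n = n ℕ.* 2
      K : List (ℕ × ℕ)
      K = pairs (down (2n ℕ.+ d))

-- Powers of square roots of one

module _ (R : CommutativeRing 0ℓ 0ℓ) where
  open CommutativeRing R hiding (_*_)
  open CommutativeRing R using () renaming (_*_ to _⋆_)
  open Algebra.Properties.Semiring.Exp semiring using (^-assocʳ) renaming (_^_ to _^ᴿ_)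

  one-power : ∀ {x} → x ≈ 1# → ∀ m → x ^ᴿ m ≈ 1#
  one-power x≈1 zero    = refl
  one-power x≈1 (suc m) = trans (*-cong x≈1 (one-power x≈1 m)) (*-identityˡ 1#)

  even-power : ∀ m x → x ⋆ x ≈ 1# → x ^ᴿ (2 ℕ.* m) ≈ 1#
  even-power m x xx = trans (sym (^-assocʳ x 2 m)) (one-power (trans (*-congˡ (*-identityʳ x)) xx) m)

  odd-power : ∀ m → 2 ∤ m → ∀ x → x ⋆ x ≈ 1# → x ^ᴿ m ≈ x
  odd-power zero          2∤m x xx = contradiction (2 ∣0) 2∤m
  odd-power (suc zero)    2∤m x xx = *-identityʳ x
  odd-power (suc (suc m)) 2∤m x xx = trans (trans (sym (*-assoc x x _)) (trans (*-congʳ xx) (*-identityˡ _)))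
    (odd-power m (2∤m ∘ ∣m∣n⇒∣m+n ∣-refl) x xx)

open import Data.Rational.Base using () renaming (+-*-rawSemiring to ℚ-rawSemiring)
open import Algebra.Definitions.RawSemiring ℚ-rawSemiring using (_^_)
open import Defs hiding (_*_)

-- Formal power series modulo high degree

module Splittings where
  open ≡ using (refl; sym; trans)
  open import Function.Base using (flip)

  module ℚ-sums = RingSums ℚ.+-*-commutativeRing
  module ∑ℚ = ℚ-sums.Sum
  open ∑ℚ using () renaming (fold to ∑ℚ)

  ∑₂ : {A B : Set} → List (A × B) → (A → B → ℚ) → ℚ
  ∑₂ xs F = ∑ℚ xs (λ (a , b) → F a b)

  -- What the decompositions s of x must satisfy for convolution along s to be
  -- commutative, associative, unital and compatible with truncation by wt.
  record Splitting {A : Set} (wt : A → ℕ) (s : A → List (A × A)) (x : A) : Set where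
    field
      comm   : ∀ F → ∑₂ (s x) F ≡ ∑₂ (s x) (flip F)
      assoc  : ∀ (F : A → A → A → ℚ) →
               ∑₂ (s x) (λ a b → ∑₂ (s a) (λ c d → F c d b)) ≡
               ∑₂ (s x) (λ c e → ∑₂ (s e) (λ d b → F c d b))
      weight : ∀ {F G} → (∀ a b → wt a ℕ.+ wt b ≡ wt x → F a b ≡ G a b) → ∑₂ (s x) F ≡ ∑₂ (s x) G
      one    : A
      wt-one : wt one ≡ 0
      unit   : ∀ {F} → (∀ a b → wt a ≢ 0 → F a b ≡ 0ℚ) → ∑₂ (s x) F ≡ F one x

  module _ {A B C : Set} {wtᴬ : A → ℕ} {wtᴮ : B → ℕ} {wtᶜ : C → ℕ}
    {sᴬ : A → List (A × A)} {sᴮ : B → List (B × B)} {sᶜ : C → List (C × C)} (k : A → B → C)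
    (s-k : ∀ x y → sᶜ (k x y) ≡ cartesianProductWith (Product.zip k k) (sᴬ x) (sᴮ y))
    (wt-k : ∀ x y → wtᶜ (k x y) ≡ wtᴬ x ℕ.+ wtᴮ y) where

    ∑₂-product : ∀ x y F → ∑₂ (sᶜ (k x y)) F ≡
      ∑₂ (sᴬ x) (λ a b → ∑₂ (sᴮ y) (λ α β → F (k a α) (k b β)))
    ∑₂-product x y F rewrite s-k x y = ∑ℚ.fold-product _ (sᴬ x) (sᴮ y) _

    -- `x` and `y` are decomposed independently, so each law holds factor by factor after
    -- interchanging sums. It is applied twice: from numbers to exponent vectors, and from those to
    -- monomials.
    product-splitting : ∀ {x y} → (∀ a → Splitting wtᴬ sᴬ a) → Splitting wtᴮ sᴮ y →
      Splitting wtᶜ sᶜ (k x y)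
    product-splitting {x} {y} S-all T = record
      { comm   = λ F → begin
          ∑₂ (sᶜ (k x y)) F
            ≡⟨ ∑₂-product x y F ⟩
          ∑₂ (sᴬ x) (λ a b → ∑₂ (sᴮ y) (λ α β → F (k a α) (k b β)))
            ≡⟨ ∑ℚ.fold-cong (sᴬ x) (λ (a , b) → T.comm (λ α β → F (k a α) (k b β))) ⟩
          ∑₂ (sᴬ x) (λ a b → ∑₂ (sᴮ y) (λ α β → F (k a β) (k b α)))
            ≡⟨ S.comm (λ a b → ∑₂ (sᴮ y) (λ α β → F (k a β) (k b α))) ⟩
          ∑₂ (sᴬ x) (λ a b → ∑₂ (sᴮ y) (λ α β → F (k b β) (k a α)))
            ≡⟨ ∑₂-product x y (flip F) ⟨
          ∑₂ (sᶜ (k x y)) (flip F) ∎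
      ; assoc  = λ F → begin
          ∑₂ (sᶜ (k x y)) (λ u v → ∑₂ (sᶜ u) (λ c d → F c d v))
            ≡⟨ ∑₂-product x y _ ⟩
          ∑₂ (sᴬ x) (λ a b → ∑₂ (sᴮ y) (λ α β → ∑₂ (sᶜ (k a α)) (λ c d → F c d (k b β))))
            ≡⟨ ∑ℚ.fold-cong (sᴬ x) (λ (a , b) → trans
                 (∑ℚ.fold-cong (sᴮ y) λ (α , β) → ∑₂-product a α _) (∑ℚ.fold-swap (sᴮ y) (sᴬ a) _)) ⟩
          ∑₂ (sᴬ x) (λ a b → ∑₂ (sᴬ a) (λ c d → ∑₂ (sᴮ y) (λ α β → ∑₂ (sᴮ α) (λ γ δ →
            F (k c γ) (k d δ) (k b β)))))
            ≡⟨ ∑ℚ.fold-cong (sᴬ x) (λ (a , b) → ∑ℚ.fold-cong (sᴬ a) λ (c , d) →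
                 T.assoc (λ γ δ β → F (k c γ) (k d δ) (k b β))) ⟩
          ∑₂ (sᴬ x) (λ a b → ∑₂ (sᴬ a) (λ c d → ∑₂ (sᴮ y) (λ γ ε → ∑₂ (sᴮ ε) (λ δ β →
            F (k c γ) (k d δ) (k b β)))))
            ≡⟨ S.assoc (λ c d b → ∑₂ (sᴮ y) (λ γ ε → ∑₂ (sᴮ ε) (λ δ β → F (k c γ) (k d δ) (k b β)))) ⟩
          ∑₂ (sᴬ x) (λ c e → ∑₂ (sᴬ e) (λ d b → ∑₂ (sᴮ y) (λ γ ε → ∑₂ (sᴮ ε) (λ δ β →
            F (k c γ) (k d δ) (k b β)))))
            ≡⟨ ∑ℚ.fold-cong (sᴬ x) (λ (c , e) → trans
                 (∑ℚ.fold-swap (sᴬ e) (sᴮ y) _)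
                 (∑ℚ.fold-cong (sᴮ y) λ (γ , ε) → sym (∑₂-product e ε λ u v → F (k c γ) u v))) ⟩
          ∑₂ (sᴬ x) (λ c e → ∑₂ (sᴮ y) (λ γ ε → ∑₂ (sᶜ (k e ε)) (λ d b → F (k c γ) d b)))
            ≡⟨ ∑₂-product x y _ ⟨
          ∑₂ (sᶜ (k x y)) (λ c e → ∑₂ (sᶜ e) (λ d b → F c d b)) ∎
      ; weight = λ {F} {G} F≡G → trans (∑₂-product x y F) (trans
          (S.weight λ a b a+b → T.weight λ α β α+β → F≡G (k a α) (k b β)
            (trans (cong₂ ℕ._+_ (wt-k a α) (wt-k b β)) (trans (interchange (wtᴬ a) (wtᴮ α) (wtᴬ b) (wtᴮ β))
              (trans (cong₂ ℕ._+_ a+b α+β) (sym (wt-k x y))))))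
          (sym (∑₂-product x y G)))
      ; one    = k S.one T.one
      ; wt-one = trans (wt-k _ _) (cong₂ ℕ._+_ S.wt-one T.wt-one)
      ; unit   = λ {F} F≡0 → trans (∑₂-product x y F) (trans
          (S.unit λ a b a≢0 → ∑ℚ.fold-ε (sᴮ y) λ (α , β) → F≡0 (k a α) (k b β)
            λ eq → a≢0 (ℕ.m+n≡0⇒m≡0 (wtᴬ a) (trans (sym (wt-k a α)) eq)))
          (T.unit λ α β α≢0 → F≡0 (k S.one α) (k x β)
            λ eq → α≢0 (ℕ.m+n≡0⇒n≡0 (wtᴬ S.one) (trans (sym (wt-k S.one α)) eq))))
      }
      where
      open ≡.≡-Reasoning
      module S = Splitting (S-all x)
      module T = Splitting T
      open import Algebra.Properties.CommutativeSemigroup ℕ.+-commutativeSemigroup using (interchange)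

  splitℕ-suc : ∀ a → splitℕ (suc a) ≡ (0 , suc a) ∷ List.map (Product.map₁ suc) (splitℕ a)
  splitℕ-suc a = cong ((0 , suc a) ∷_) (begin
    List.map (λ i → i , suc a ℕ.∸ i) (applyUpTo suc (suc a))
      ≡⟨ List.map-applyUpTo suc _ (suc a) ⟩
    applyUpTo (λ i → suc i , a ℕ.∸ i) (suc a)
      ≡⟨ List.map-applyUpTo (λ i → i) (λ i → suc i , a ℕ.∸ i) (suc a) ⟨
    List.map (λ i → suc i , a ℕ.∸ i) (upTo (suc a))
      ≡⟨ List.map-∘ (upTo (suc a)) ⟩
    List.map (Product.map₁ suc) (splitℕ a) ∎)
    where open ≡.≡-Reasoning

  ∑-splitℕ : ∀ a F → ∑₂ (splitℕ (suc a)) F ≡ F 0 (suc a) ℚ.+ ∑₂ (splitℕ a) (λ i j → F (suc i) j)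
  ∑-splitℕ a F = trans (cong (λ ps → ∑₂ ps F) (splitℕ-suc a))
    (cong (F 0 (suc a) ℚ.+_) (∑ℚ.fold-map (Product.map₁ suc) (splitℕ a) (λ (i , j) → F i j)))

  ∑-splitℕ-last : ∀ a F → ∑₂ (splitℕ (suc a)) F ≡ ∑₂ (splitℕ a) (λ i j → F i (suc j)) ℚ.+ F (suc a) 0
  ∑-splitℕ-last zero    F = trans (cong (F 0 1 ℚ.+_) (ℚ.+-identityʳ (F 1 0)))
    (cong (ℚ._+ F 1 0) (sym (ℚ.+-identityʳ (F 0 1))))
  ∑-splitℕ-last (suc a) F = begin
    ∑₂ (splitℕ (suc (suc a))) F
      ≡⟨ ∑-splitℕ (suc a) F ⟩
    F 0 (suc (suc a)) ℚ.+ ∑₂ (splitℕ (suc a)) (λ i j → F (suc i) j)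
      ≡⟨ cong (F 0 (suc (suc a)) ℚ.+_) (∑-splitℕ-last a (λ i j → F (suc i) j)) ⟩
    F 0 (suc (suc a)) ℚ.+ (∑₂ (splitℕ a) (λ i j → F (suc i) (suc j)) ℚ.+ F (suc (suc a)) 0)
      ≡⟨ ℚ.+-assoc (F 0 (suc (suc a))) _ _ ⟨
    (F 0 (suc (suc a)) ℚ.+ ∑₂ (splitℕ a) (λ i j → F (suc i) (suc j))) ℚ.+ F (suc (suc a)) 0
      ≡⟨ cong (ℚ._+ F (suc (suc a)) 0) (∑-splitℕ a (λ i j → F i (suc j))) ⟨
    ∑₂ (splitℕ (suc a)) (λ i j → F i (suc j)) ℚ.+ F (suc (suc a)) 0 ∎
    where open ≡.≡-Reasoning

  splitℕ-comm : ∀ a F → ∑₂ (splitℕ a) F ≡ ∑₂ (splitℕ a) (flip F)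
  splitℕ-comm zero    F = refl
  splitℕ-comm (suc a) F = begin
    ∑₂ (splitℕ (suc a)) F
      ≡⟨ ∑-splitℕ a F ⟩
    F 0 (suc a) ℚ.+ ∑₂ (splitℕ a) (λ i j → F (suc i) j)
      ≡⟨ ℚ.+-comm (F 0 (suc a)) _ ⟩
    ∑₂ (splitℕ a) (λ i j → F (suc i) j) ℚ.+ F 0 (suc a)
      ≡⟨ cong (ℚ._+ F 0 (suc a)) (splitℕ-comm a (λ i j → F (suc i) j)) ⟩
    ∑₂ (splitℕ a) (λ i j → F (suc j) i) ℚ.+ F 0 (suc a)
      ≡⟨ ∑-splitℕ-last a (flip F) ⟨
    ∑₂ (splitℕ (suc a)) (flip F) ∎
    where open ≡.≡-Reasoning

  -- Both sides sum over the triples j + l + k = a. Those with j = 0 are split off, and in the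
  -- others j drops by one.
  splitℕ-assoc : ∀ a (F : ℕ → ℕ → ℕ → ℚ) →
    ∑₂ (splitℕ a) (λ i k → ∑₂ (splitℕ i) (λ j l → F j l k)) ≡
    ∑₂ (splitℕ a) (λ j e → ∑₂ (splitℕ e) (λ l k → F j l k))
  splitℕ-assoc zero    F = refl
  splitℕ-assoc (suc a) F = begin
    ∑₂ (splitℕ (suc a)) (λ i k → ∑₂ (splitℕ i) (λ j l → F j l k))
      ≡⟨ ∑-splitℕ a (λ i k → ∑₂ (splitℕ i) (λ j l → F j l k)) ⟩
    (F 0 0 (suc a) ℚ.+ 0ℚ) ℚ.+ ∑₂ (splitℕ a) (λ i k → ∑₂ (splitℕ (suc i)) (λ j l → F j l k))
      ≡⟨ cong₂ ℚ._+_ (ℚ.+-identityʳ (F 0 0 (suc a)))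
           (trans (∑ℚ.fold-cong (splitℕ a) λ (i , k) → ∑-splitℕ i (λ j l → F j l k))
                  (∑ℚ.fold-∙ (splitℕ a) (λ (i , k) → F 0 (suc i) k) _)) ⟩
    F 0 0 (suc a) ℚ.+ (X ℚ.+ ∑₂ (splitℕ a) (λ i k → ∑₂ (splitℕ i) (λ j l → F (suc j) l k)))
      ≡⟨ cong (λ q → F 0 0 (suc a) ℚ.+ (X ℚ.+ q)) (splitℕ-assoc a (λ j l k → F (suc j) l k)) ⟩
    F 0 0 (suc a) ℚ.+ (X ℚ.+ Y)
      ≡⟨ ℚ.+-assoc (F 0 0 (suc a)) X Y ⟨
    (F 0 0 (suc a) ℚ.+ X) ℚ.+ Y
      ≡⟨ cong (ℚ._+ Y) (∑-splitℕ a (λ l k → F 0 l k)) ⟨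
    ∑₂ (splitℕ (suc a)) (λ l k → F 0 l k) ℚ.+ Y
      ≡⟨ ∑-splitℕ a (λ j e → ∑₂ (splitℕ e) (λ l k → F j l k)) ⟨
    ∑₂ (splitℕ (suc a)) (λ j e → ∑₂ (splitℕ e) (λ l k → F j l k)) ∎
    where
    open ≡.≡-Reasoning
    X Y : ℚ
    X = ∑₂ (splitℕ a) (λ i k → F 0 (suc i) k)
    Y = ∑₂ (splitℕ a) (λ j e → ∑₂ (splitℕ e) (λ l k → F (suc j) l k))

  splitℕ-weight : ∀ a {F G} → (∀ i j → i ℕ.+ j ≡ a → F i j ≡ G i j) → ∑₂ (splitℕ a) F ≡ ∑₂ (splitℕ a) G
  splitℕ-weight zero    F≡G = cong (ℚ._+ 0ℚ) (F≡G 0 0 refl)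
  splitℕ-weight (suc a) {F} {G} F≡G = trans (∑-splitℕ a F) (trans
    (cong₂ ℚ._+_ (F≡G 0 (suc a) refl) (splitℕ-weight a λ i j i+j → F≡G (suc i) j (cong suc i+j)))
    (sym (∑-splitℕ a G)))

  splitℕ-unit : ∀ a {F} → (∀ i j → i ≢ 0 → F i j ≡ 0ℚ) → ∑₂ (splitℕ a) F ≡ F 0 a
  splitℕ-unit zero    {F} F≡0 = ℚ.+-identityʳ (F 0 0)
  splitℕ-unit (suc a) {F} F≡0 = trans (∑-splitℕ a F) (trans
    (cong (F 0 (suc a) ℚ.+_) (∑ℚ.fold-ε (splitℕ a) λ (i , j) → F≡0 (suc i) j λ ()))
    (ℚ.+-identityʳ _))

  splittingℕ : ∀ a → Splitting (λ i → i) splitℕ a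
  splittingℕ a = record
    { comm = splitℕ-comm a ; assoc = splitℕ-assoc a ; weight = splitℕ-weight a
    ; one = 0 ; wt-one = refl ; unit = splitℕ-unit a }

  nil-splitting : {A : Set} {wt : A → ℕ} {s : A → List (A × A)} {x : A} →
    s x ≡ (x , x) ∷ [] → wt x ≡ 0 → Splitting wt s x
  nil-splitting {wt = wt} {s} {x} s-x wt-x = record
    { comm   = λ F → trans (at-x F) (sym (at-x (flip F)))
    ; assoc  = λ F → trans (at-x _) (trans (at-x _) (sym (trans (at-x _) (at-x _))))
    ; weight = λ {F} {G} F≡G → trans (at-x F) (trans
        (F≡G x x (cong₂ ℕ._+_ wt-x refl)) (sym (at-x G)))
    ; one    = x
    ; wt-one = wt-x
    ; unit   = λ {F} _ → at-x F }
    where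
    at-x : ∀ F → ∑₂ (s x) F ≡ F x x
    at-x F rewrite s-x = ℚ.+-identityʳ (F x x)

  total : Monomial M → ℕ
  total μ = sum (List.map Vec.sum μ)

  splittingᵛ : ∀ {M} (e : Vec ℕ M) → Splitting Vec.sum splitᵛ e
  splittingᵛ []      = nil-splitting refl refl
  splittingᵛ (a ∷ e) = product-splitting _∷_ (λ _ _ → refl) (λ _ _ → refl) splittingℕ (splittingᵛ e)

  splitting : ∀ {M} (μ : Monomial M) → Splitting total split μ
  splitting []      = nil-splitting refl refl
  splitting (e ∷ μ) = product-splitting _∷_ (λ _ _ → refl) (λ _ _ → refl) splittingᵛ (splitting μ)

open Splittings

total-pad : ∀ {M} (μ : Monomial M) → total (μ List.∷ʳ replicate M 0) ≡ total μ
total-pad {M} = sum-pad Vec.sum (sum-0 M)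

-- The ring of series modulo degree above D

module Truncated (M D : ℕ) where
  infix 4 _≈_
  open Defs using (_*_)

  -- A congruence on the series themselves in place of a quotient: the carrier does not depend on
  -- `D`, and an identity that holds for every `D` is an identity of series.
  record _≈_ (f g : Series M) : Set where
    constructor mk≈
    field at : ∀ μ → total μ ℕ.≤ D → coeff f μ ≡ coeff g μ
  open _≈_ public

  coefficientwise : ∀ {f g} → (∀ μ → coeff f μ ≡ coeff g μ) → f ≈ g
  coefficientwise f≡g = mk≈ λ μ _ → f≡g μ

  neg : Series M → Series M
  neg f = (ℚ.- 1ℚ) • f

  -- The degrees of two factors add up to that of their product, so a coefficient within the bound
  -- involves only coefficients within the bound.
  *-cong : ∀ {f f′ g g′} → f ≈ f′ → g ≈ g′ → f * g ≈ f′ * g′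
  *-cong f≈f′ g≈g′ = mk≈ λ μ μ≤D → Splitting.weight (splitting μ) λ α β α+β → cong₂ ℚ._*_
    (at f≈f′ α (ℕ.≤-trans (ℕ.m≤m+n _ _) (ℕ.≤-trans (ℕ.≤-reflexive α+β) μ≤D)))
    (at g≈g′ β (ℕ.≤-trans (ℕ.m≤n+m _ _) (ℕ.≤-trans (ℕ.≤-reflexive α+β) μ≤D)))

  *-assoc : ∀ f g k → (f * g) * k ≈ f * (g * k)
  *-assoc f g k = coefficientwise λ μ → begin
    ∑₂ (split μ) (λ α β → ∑₂ (split α) (λ γ δ → coeff f γ ℚ.* coeff g δ) ℚ.* coeff k β)
      ≡⟨ ∑ℚ.fold-cong (split μ) (λ (α , β) → ℚ-sums.∑-distribʳ (coeff k β) (split α) _) ⟨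
    ∑₂ (split μ) (λ α β → ∑₂ (split α) (λ γ δ → coeff f γ ℚ.* coeff g δ ℚ.* coeff k β))
      ≡⟨ Splitting.assoc (splitting μ) (λ γ δ β → coeff f γ ℚ.* coeff g δ ℚ.* coeff k β) ⟩
    ∑₂ (split μ) (λ γ ε → ∑₂ (split ε) (λ δ β → coeff f γ ℚ.* coeff g δ ℚ.* coeff k β))
      ≡⟨ ∑ℚ.fold-cong (split μ) (λ (γ , ε) → ≡.trans
           (∑ℚ.fold-cong (split ε) λ (δ , β) → ℚ.*-assoc (coeff f γ) (coeff g δ) (coeff k β))
           (ℚ-sums.∑-distribˡ (coeff f γ) (split ε) _)) ⟩
    ∑₂ (split μ) (λ γ ε → coeff f γ ℚ.* ∑₂ (split ε) (λ δ β → coeff g δ ℚ.* coeff k β)) ∎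
    where open ≡.≡-Reasoning

  *-comm : ∀ f g → f * g ≈ g * f
  *-comm f g = coefficientwise λ μ → ≡.trans (Splitting.comm (splitting μ) λ α β → coeff f α ℚ.* coeff g β)
    (∑ℚ.fold-cong (split μ) λ (α , β) → ℚ.*-comm (coeff f β) (coeff g α))

  coeff-one : ∀ μ → total μ ≡ 0 → coeff (1ˢ {M}) μ ≡ 1ℚ
  coeff-one μ eq rewrite eq = ≡.refl

  coeff-one-0 : ∀ μ → total μ ≢ 0 → coeff (1ˢ {M}) μ ≡ 0ℚ
  coeff-one-0 μ ≢0 with total μ
  ... | zero  = contradiction ≡.refl ≢0
  ... | suc _ = ≡.refl

  *-identityˡ : ∀ f → 1ˢ * f ≈ f
  *-identityˡ f = coefficientwise λ μ → ≡.trans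
    (Splitting.unit (splitting μ) λ α β α≢0 →
      ≡.trans (cong (ℚ._* coeff f β) (coeff-one-0 α α≢0)) (ℚ.*-zeroˡ (coeff f β)))
    (≡.trans (cong (ℚ._* coeff f μ) (coeff-one (Splitting.one (splitting μ)) (Splitting.wt-one (splitting μ)))) (ℚ.*-identityˡ (coeff f μ)))

  distribˡ : ∀ f g k → f * (g + k) ≈ f * g + f * k
  distribˡ f g k = coefficientwise λ μ → ≡.trans
    (∑ℚ.fold-cong (split μ) λ (α , β) → ℚ.*-distribˡ-+ (coeff f α) (coeff g β) (coeff k β))
    (∑ℚ.fold-∙ (split μ) _ _)

  inverseˡ : ∀ f → neg f + f ≈ 0ˢ
  inverseˡ f = coefficientwise λ μ → ≡.trans
    (cong (ℚ._+ coeff f μ) (≡.trans (≡.sym (ℚ.neg-distribˡ-* 1ℚ (coeff f μ))) (cong ℚ.-_ (ℚ.*-identityˡ (coeff f μ)))))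
    (ℚ.+-inverseˡ (coeff f μ))

  ≈-trans : ∀ {f g k} → f ≈ g → g ≈ k → f ≈ k
  ≈-trans p q = mk≈ λ μ l → ≡.trans (at p μ l) (at q μ l)

  ring : CommutativeRing 0ℓ 0ℓ
  ring = record
    { Carrier = Series M ; _≈_ = _≈_ ; _+_ = _+_ ; _*_ = _*_ ; -_ = neg ; 0# = 0ˢ ; 1# = 1ˢ
    ; isCommutativeRing = record
      { isRing = record
        { +-isAbelianGroup = record
          { isGroup = record
            { isMonoid = record
              { isSemigroup = record
                { isMagma = record
                  { isEquivalence = record
                    { refl  = mk≈ λ _ _ → ≡.refl
                    ; sym   = λ p → mk≈ λ μ l → ≡.sym (at p μ l)
                    ; trans = ≈-trans }
                  ; ∙-cong = λ p q → mk≈ λ μ l → cong₂ ℚ._+_ (at p μ l) (at q μ l) }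
                ; assoc = λ f g k → coefficientwise λ μ → ℚ.+-assoc (coeff f μ) (coeff g μ) (coeff k μ) }
              ; identity = (λ f → coefficientwise λ μ → ℚ.+-identityˡ (coeff f μ))
                         , (λ f → coefficientwise λ μ → ℚ.+-identityʳ (coeff f μ)) }
            ; inverse = inverseˡ , λ f → ≈-trans
                (coefficientwise λ μ → ℚ.+-comm (coeff f μ) (coeff (neg f) μ)) (inverseˡ f)
            ; ⁻¹-cong = λ p → mk≈ λ μ l → cong (ℚ.- 1ℚ ℚ.*_) (at p μ l) }
          ; comm = λ f g → coefficientwise λ μ → ℚ.+-comm (coeff f μ) (coeff g μ) }
        ; *-cong = *-cong
        ; *-assoc = *-assoc
        ; *-identity = *-identityˡ , λ f → ≈-trans (*-comm f 1ˢ) (*-identityˡ f)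
        ; distrib = distribˡ , λ f g k → ≈-trans (*-comm (g + k) f) (≈-trans (distribˡ f g k)
            (mk≈ λ μ l → cong₂ ℚ._+_ (at (*-comm f g) μ l) (at (*-comm f k) μ l))) }
      ; *-comm = *-comm } }

  halve : ∀ f → f ≈ neg f → f ≈ 0ˢ
  halve f f≈-f = mk≈ λ μ l → let q = coeff f μ in begin
    q                                 ≡⟨ ℚ.*-identityˡ q ⟨
    (½ ℚ.+ ½) ℚ.* q                   ≡⟨ ℚ.*-distribʳ-+ q ½ ½ ⟩
    ½ ℚ.* q ℚ.+ ½ ℚ.* q               ≡⟨ cong (λ r → ½ ℚ.* q ℚ.+ ½ ℚ.* r) (at f≈-f μ l) ⟩
    ½ ℚ.* q ℚ.+ ½ ℚ.* (ℚ.- 1ℚ ℚ.* q)  ≡⟨ cong (½ ℚ.* q ℚ.+_) (ℚ.*-assoc ½ (ℚ.- 1ℚ) q) ⟨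
    ½ ℚ.* q ℚ.+ (ℚ.- ½) ℚ.* q         ≡⟨ ℚ.*-distribʳ-+ q ½ (ℚ.- ½) ⟨
    0ℚ ℚ.* q                          ≡⟨ ℚ.*-zeroˡ q ⟩
    0ℚ                                ∎
    where open ≡.≡-Reasoning

-- Coefficients, factorials and limits

module _ {M : ℕ} where
  lookup≤sum : ∀ {M} (e : Vec ℕ M) s → lookup e s ℕ.≤ Vec.sum e
  lookup≤sum (a ∷ e) Fin.zero    = ℕ.m≤m+n a _
  lookup≤sum (a ∷ e) (Fin.suc s) = ℕ.≤-trans (lookup≤sum e s) (ℕ.m≤n+m _ a)

  degree≤total : (s : Fin M) (μ : Monomial M) → sum (List.map (λ e → lookup e s) μ) ℕ.≤ total μ
  degree≤total s []      = ℕ.z≤n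
  degree≤total s (e ∷ μ) = ℕ.+-mono-≤ (lookup≤sum e s) (degree≤total s μ)

  -- The degree in one alphabet is at most the total degree, so of the two conditions in `h s (+ 0)`
  -- that on the total degree decides.
  h-zero : (s : Fin M) (μ : Monomial M) → coeff (h s (+ 0)) μ ≡ coeff 1ˢ μ
  h-zero s μ with sum (List.map (λ e → lookup e s) μ) | total μ | degree≤total s μ
  ... | zero  | _     | _ = ≡.refl
  ... | suc _ | suc _ | _ = ≡.refl

  h-large : (s : Fin M) (k : ℕ) (μ : Monomial M) → total μ ℕ.< k → coeff (h s (+ k)) μ ≡ 0ℚ
  h-large s k μ μ<k with total μ ≡ᵇ k in eq
  ... | false rewrite Bool.∧-zeroʳ (sum (List.map (λ e → lookup e s) μ) ≡ᵇ k) = ≡.refl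
  ... | true  = contradiction
    (ℕ.≡ᵇ⇒≡ (total μ) k (subst Bool.T (≡.sym eq) _)) (ℕ.<⇒≢ μ<k)

nat : ℕ → ℚ
nat k = + k ℚ./ 1

nat-suc : ∀ k → 1ℚ ℚ.+ nat k ≡ nat (suc k)
nat-suc k = ℚ.toℚᵘ-injective (begin
  ℚ.toℚᵘ (1ℚ ℚ.+ nat k)                ≈⟨ ℚ.toℚᵘ-homo-+ 1ℚ (nat k) ⟩
  ℚ.toℚᵘ 1ℚ ℚᵘ.+ ℚ.toℚᵘ (nat k)         ≈⟨ ℚᵘ.+-congʳ (ℚ.toℚᵘ 1ℚ) (ℚ.toℚᵘ-fromℚᵘ (ℚᵘ.mkℚᵘ (+ k) 0)) ⟩
  ℚᵘ.mkℚᵘ (+ 1) 0 ℚᵘ.+ ℚᵘ.mkℚᵘ (+ k) 0  ≈⟨ ℚᵘ.*≡* (cong (ℤ._* + 1) (cong (λ z → + 1 ℤ.+ z) (ℤ.*-identityʳ (+ k)))) ⟩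
  ℚᵘ.mkℚᵘ (+ suc k) 0                  ≈⟨ ℚ.toℚᵘ-fromℚᵘ (ℚᵘ.mkℚᵘ (+ suc k) 0) ⟨
  ℚ.toℚᵘ (nat (suc k))                 ∎)
  where open ℚᵘ.≃-Reasoning

nat-inverse : ∀ k .{{_ : ℕ.NonZero k}} → (+ 1 ℚ./ k) ℚ.* nat k ≡ 1ℚ
nat-inverse k@(suc k-1) = ℚ.toℚᵘ-injective (begin
  ℚ.toℚᵘ ((+ 1 ℚ./ k) ℚ.* nat k)            ≈⟨ ℚ.toℚᵘ-homo-* (+ 1 ℚ./ k) (nat k) ⟩
  ℚ.toℚᵘ (+ 1 ℚ./ k) ℚᵘ.* ℚ.toℚᵘ (nat k)
    ≈⟨ ℚᵘ.*-cong (ℚ.toℚᵘ-fromℚᵘ (ℚᵘ.mkℚᵘ (+ 1) k-1)) (ℚ.toℚᵘ-fromℚᵘ (ℚᵘ.mkℚᵘ (+ k) 0)) ⟩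
  ℚᵘ.mkℚᵘ (+ 1) k-1 ℚᵘ.* ℚᵘ.mkℚᵘ (+ k) 0
    ≈⟨ ℚᵘ.*≡* (≡.trans (ℤ.*-identityʳ _) (≡.trans (ℤ.*-identityˡ (+ k))
         (≡.sym (≡.trans (ℤ.*-identityˡ _) (cong +_ (ℕ.*-identityʳ k)))))) ⟩
  ℚ.toℚᵘ 1ℚ                                 ∎)
  where open ℚᵘ.≃-Reasoning

coeff-∑ : (xs : List A) (f : A → Series M) → ∀ μ → coeff (∑ xs f) μ ≡ sumℚ (List.map (λ x → coeff (f x) μ) xs)
coeff-∑ []       f μ = ≡.refl
coeff-∑ (x ∷ xs) f μ = cong (coeff (f x) μ ℚ.+_) (coeff-∑ xs f μ)

-- The limit of a sequence whose term `F d` is final up to degree `d`. The infinite array entries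
-- arise in this way from their partial sums.
diagonal : (ℕ → Series M) → Series M
diagonal {M} F = mkSeries (λ μ → coeff (F (total μ)) μ)
  (λ μ → ≡.trans (cong (λ d → coeff (F d) (μ List.∷ʳ replicate M 0)) (total-pad μ)) (padded (F (total μ)) μ))

hasSum-diagonal : (I : ℕ → List A) (f : A → Series M) → (∀ d → Unique (I d)) →
  (∀ d a → ¬ Truncated._≈_ M d (f a) 0ˢ → a ∈ I d) → HasSum f (diagonal (λ d → ∑ (I d) f))
hasSum-diagonal I f unique complete μ = I (total μ) , unique (total μ) ,
  (λ a ≢0 → complete (total μ) a (λ ≈0 → ≢0 (Truncated.at ≈0 μ ℕ.≤-refl))) ,
  coeff-∑ (I (total μ)) f μ

diagonal-≈ : (F : ℕ → Series M) → (∀ d → Truncated._≈_ M d (F (suc d)) (F d)) →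
  ∀ D → Truncated._≈_ M D (diagonal F) (F D)
diagonal-≈ {M} F stable D = Truncated.mk≈ λ μ μ≤D → go (ℕ.≤⇒≤′ μ≤D)
  where
  go : ∀ {D μ} → total μ ℕ.≤′ D → coeff (F (total μ)) μ ≡ coeff (F D) μ
  go (ℕ.≤′-reflexive ≡.refl)      = ≡.refl
  go {μ = μ} (ℕ.≤′-step {D} μ≤D) =
    ≡.trans (go μ≤D) (≡.sym (Truncated.at (stable D) μ (ℕ.≤′⇒≤ μ≤D)))

-- The two identities modulo degree above D

module Identities {M : ℕ} (D : ℕ) where
  open Defs using (_*_)
  open Truncated M D using (ring; halve; at; mk≈; coefficientwise)
  open CommutativeRing ring
    using ( _≈_; refl; sym; trans; reflexive; setoid; semiring; -_; +-cong; +-identityʳ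
          ; *-congˡ; *-congʳ; *-assoc; *-comm; *-identityˡ; *-identityʳ)
  open import Relation.Binary.Reasoning.Setoid setoid
  open Algebra.Properties.Semiring.Exp semiring using () renaming (_^_ to _^ᴿ_)
  open Algebra.Properties.Semiring.Mult semiring using () renaming (_×_ to infixr 7 _·_)
  open Alternating ring halve using (module Sum; module Prod; minor; sgnᴿ; -1^-square; ∏-zero; module Families)

  •-cong : ∀ c {f g} → f ≈ g → c • f ≈ c • g
  •-cong c f≈g = mk≈ λ μ l → cong (c ℚ.*_) (at f≈g μ l)

  •-• : ∀ c d f → c • d • f ≈ (c ℚ.* d) • f
  •-• c d f = coefficientwise λ μ → ≡.sym (ℚ.*-assoc c d (coeff f μ))

  •-one : ∀ f → 1ℚ • f ≈ f
  •-one f = coefficientwise λ μ → ℚ.*-identityˡ (coeff f μ)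

  •-* : ∀ c f g → (c • f) * g ≈ c • (f * g)
  •-* c f g = coefficientwise λ μ → ≡.trans
    (∑ℚ.fold-cong (split μ) λ (α , β) → ℚ.*-assoc c (coeff f α) (coeff g β))
    (ℚ-sums.∑-distribˡ c (split μ) _)

  •-≈ : ∀ c f → c • f ≈ (c • 1ˢ) * f
  •-≈ c f = sym (trans (•-* c 1ˢ f) (•-cong c (*-identityˡ f)))

  •-power : ∀ k f → (ℚ.- 1ℚ) ^ k • f ≈ (- 1ˢ) ^ᴿ k * f
  •-power zero    f = trans (•-one f) (sym (*-identityˡ f))
  •-power (suc k) f = begin
    (ℚ.- 1ℚ ℚ.* (ℚ.- 1ℚ) ^ k) • f      ≈⟨ •-• (ℚ.- 1ℚ) ((ℚ.- 1ℚ) ^ k) f ⟨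
    (ℚ.- 1ℚ) • (ℚ.- 1ℚ) ^ k • f        ≈⟨ •-≈ (ℚ.- 1ℚ) _ ⟩
    (- 1ˢ) * ((ℚ.- 1ℚ) ^ k • f)        ≈⟨ *-congˡ {x = - 1ˢ} (•-power k f) ⟩
    (- 1ˢ) * ((- 1ˢ) ^ᴿ k * f)         ≈⟨ *-assoc (- 1ˢ) ((- 1ˢ) ^ᴿ k) f ⟨
    (- 1ˢ) ^ᴿ suc k * f                ∎

  sgns-• : ∀ {n k} (σs : Vec (Vec (Fin n) n) k) f →
    sgns σs • f ≈ ∏ (allFin k) (λ s → sgnᴿ (lookup σs s)) * f
  sgns-• []       f = trans (•-one f) (sym (*-identityˡ f))
  sgns-• {k = suc k} (σ ∷ σs) f = begin
    (sgn σ ℚ.* sgns σs) • f    ≈⟨ •-• (sgn σ) (sgns σs) f ⟨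
    sgn σ • sgns σs • f        ≈⟨ •-power (inversions σ) _ ⟩
    sgnᴿ σ * (sgns σs • f)     ≈⟨ *-congˡ {x = sgnᴿ σ} (sgns-• σs f) ⟩
    sgnᴿ σ * (∏ (allFin k) (λ s → sgnᴿ (lookup σs s)) * f)
                               ≈⟨ *-assoc (sgnᴿ σ) _ f ⟨
    sgnᴿ σ * ∏ (allFin k) (λ s → sgnᴿ (lookup σs s)) * f
                               ≡⟨ cong (_* f) (Prod.fold-suc k λ s → sgnᴿ (lookup (σ ∷ σs) s)) ⟨
    ∏ (allFin (suc k)) (λ s → sgnᴿ (lookup (σ ∷ σs) s)) * f ∎

  ·-• : ∀ k f → k · f ≈ nat k • f
  ·-• zero    f = coefficientwise λ μ → ≡.sym (ℚ.*-zeroˡ (coeff f μ))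
  ·-• (suc k) f = trans (+-cong (sym (•-one f)) (·-• k f)) (coefficientwise λ μ →
    ≡.trans (≡.sym (ℚ.*-distribʳ-+ (coeff f μ) 1ℚ (nat k))) (cong (ℚ._* coeff f μ) (nat-suc k)))

  factorial-cancel : ∀ n f → 1/ n ! • (n ! · f) ≈ f
  factorial-cancel n f = trans (•-cong (1/ n !) (·-• (n !) f)) (trans (•-• (1/ n !) (nat (n !)) f)
    (trans (reflexive (cong (_• f) (nat-inverse (n !) {{n ℕ.!≢0}}))) (•-one f)))

  h-zero≈ : (s : Fin M) → h s (+ 0) ≈ 1ˢ
  h-zero≈ s = coefficientwise (h-zero s)

  h-negative≈ : (s : Fin M) (k : ℕ) → h s -[1+ k ] ≈ 0ˢ
  h-negative≈ s k = refl

  h-large≈ : ∀ (s : Fin M) {k} → D ℕ.< k → h s (+ k) ≈ 0ˢ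
  h-large≈ s D<k = mk≈ λ μ μ≤D → h-large s _ μ (ℕ.≤-<-trans μ≤D D<k)

  -- Column numbers are at most `n`, so the subscript still exceeds `D`.
  entry-large : ∀ (s : Fin M) {n k} → n ℕ.+ D ℕ.< k → (j : Fin n) → h s (+ k ℤ.- pos j) ≈ 0ˢ
  entry-large s {n} {k} n+D<k j = trans
    (reflexive (cong (h s) (≡.trans (ℤ.m-n≡m⊖n k (suc (toℕ j))) (ℤ.⊖-≥ j<k))))
    (h-large≈ s (ℕ.m+n≤o⇒m≤o∸n (suc D) (ℕ.≤-trans (ℕ.+-monoʳ-≤ (suc D) (Fin.toℕ<n j))
      (subst (ℕ._≤ k) (cong suc (ℕ.+-comm n D)) n+D<k))))
    where
    j<k : suc (toℕ j) ℕ.≤ k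
    j<k = ℕ.≤-trans (Fin.toℕ<n j) (ℕ.≤-trans (ℕ.m≤m+n n D) (ℕ.<⇒≤ n+D<k))

  -- The second product is written `c * b` to fit `minor`, which has the letters as rows, whereas
  -- the matrix in `termPf` has them as columns.
  det₂ : ∀ a b c d → det (matrix₂ a b c d) ≈ a * d + - (c * b)
  det₂ a b c d = +-cong
    (trans (•-one _) (*-congˡ {x = a} (*-identityʳ d)))
    (trans (+-identityʳ _) (•-cong (ℚ.- 1ℚ) (trans (*-congˡ {x = b} (*-identityʳ c)) (*-comm b c))))

  module Sums (s₀ : Fin M) where
    open Families s₀ h h-zero≈ h-negative≈ using (module H; det-expansion; pf-expansion)

    schur-≈ : ∀ p s → schur p s ≈ H.schurᴿ s (parts p)
    schur-≈ p s = Sum.fold-cong (𝔖 (ℓ p)) λ σ → •-power (inversions σ) _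

    -- The parts decrease already, so the bound can fail only because the first part exceeds `D`.
    -- Then all subscripts in the first row exceed `D` as well.
    schur-large : ∀ p → ¬ Linked _≥_ (D ∷ parts p) → ∏ (allFin M) (schur p) ≈ 0ˢ
    schur-large (mkPartition [] _ _) ¬bounded = contradiction [-] ¬bounded
    schur-large (mkPartition (x ∷ xs) pos dec) ¬bounded with x ℕ.≤? D
    ... | yes x≤D = contradiction (x≤D ∷ dec) ¬bounded
    ... | no  x≰D = ∏-zero s₀ (schur (mkPartition (x ∷ xs) pos dec)) (Sum.fold-ε (𝔖 (suc (List.length xs))) λ σ → trans
      (•-cong (sgn σ) (∏-zero 0F (λ i → h s₀ (+ List.lookup (x ∷ xs) i ℤ.- + toℕ i ℤ.+ + toℕ (lookup σ i)))
        (h-large≈ s₀ (D<entry (toℕ (lookup σ 0F))))))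
      (coefficientwise λ μ → ℚ.*-zeroʳ (sgn σ)))
      where
      D<entry : ∀ j → D ℕ.< x ℕ.+ 0 ℕ.+ j
      D<entry j = ℕ.<-≤-trans (ℕ.≰⇒> x≰D) (ℕ.≤-trans (ℕ.m≤m+n x 0) (ℕ.m≤m+n (x ℕ.+ 0) j))

    ∑-partitions : ∀ n → ∑ (shapes n D) (λ xs → ∏ (allFin M) λ s → H.schurᴿ s xs) ≈
      ∑ (partitions n D) (λ p → ∏ (allFin M) (schur (proj₁ p)))
    ∑-partitions n = begin
      ∑ (shapes n D) F                         ≡⟨ cong (λ xss → ∑ xss F) (map-fromShapes (shapes-sound n D)) ⟨
      ∑ (List.map partsOf (partitions n D)) F  ≡⟨ Sum.fold-map partsOf (partitions n D) F ⟩
      ∑ (partitions n D) (F ∘ partsOf)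
        ≈⟨ Sum.fold-cong (partitions n D) (λ p → Prod.fold-cong (allFin M) λ s → schur-≈ (proj₁ p) s) ⟨
      ∑ (partitions n D) (λ p → ∏ (allFin M) (schur (proj₁ p))) ∎
      where
      F : List ℕ → Series M
      F xs = ∏ (allFin M) λ s → H.schurᴿ s xs

    hyperdeterminant : (∀ x → x * x ≈ 1ˢ → x ^ᴿ M ≈ 1ˢ) → ∀ n (a : Vec (Fin n) M → Series M) →
      (∀ i → a i ≈ ∑ (down (n ℕ.+ D)) λ k → ∏ (allFin M) λ s → h s (+ k ℤ.- pos (lookup i s))) →
      1/ n ! • ∑ (words M (𝔖 n)) (λ σs → sgns σs • ∏ (allFin n) λ i → a (Vec.map (λ σ → lookup σ i) σs)) ≈
      ∑ (partitions n D) (λ p → ∏ (allFin M) (schur (proj₁ p)))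
    hyperdeterminant even n a a≈ = trans (•-cong (1/ n !) (begin
      ∑ (words M (𝔖 n)) (λ σs → sgns σs • ∏ (allFin n) λ i → a (Vec.map (λ σ → lookup σ i) σs))
        ≈⟨ Sum.fold-cong (words M (𝔖 n)) (λ σs → trans (sgns-• σs _)
             (*-congˡ {x = ∏ (allFin M) (λ s → sgnᴿ (lookup σs s))} (Prod.fold-cong (allFin n) λ i →
               trans (a≈ (Vec.map (λ σ → lookup σ i) σs)) (Sum.fold-cong (down (n ℕ.+ D)) λ k →
               Prod.fold-cong (allFin M) λ s → reflexive (cong (λ j → h s (+ k ℤ.- pos j))
                 (Vec.lookup-map s (λ σ → lookup σ i) σs)))))) ⟩
      _
        ≈⟨ det-expansion even n D ⟩
      n ! · ∑ (shapes n D) (λ xs → ∏ (allFin M) λ s → H.schurᴿ s xs) ∎))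
      (trans (factorial-cancel n _) (∑-partitions n))

    hyperpfaffian : (∀ x → x * x ≈ 1ˢ → x ^ᴿ M ≈ x) → ∀ n (b : Vec (Fin (n ℕ.* 2)) (M ℕ.* 2) → Series M) →
      (∀ i → b i ≈ ∑ (indices (n ℕ.* 2 ℕ.+ D)) (termPf M n i)) →
      ((ℚ.- 1ℚ) ^ n) • Pf M n b ≈ ∑ (partitions (n ℕ.* 2) D) (λ p → ∏ (allFin M) (schur (proj₁ p)))
    hyperpfaffian odd-M n b b≈ = begin
      ((ℚ.- 1ℚ) ^ n) • Pf M n b
        ≈⟨ •-cong ((ℚ.- 1ℚ) ^ n) (trans (•-cong (1/ n !) expanded) (factorial-cancel n _)) ⟩
      ((ℚ.- 1ℚ) ^ n) • ((- 1ˢ) ^ᴿ n * X)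
        ≈⟨ •-power n _ ⟩
      (- 1ˢ) ^ᴿ n * ((- 1ˢ) ^ᴿ n * X)
        ≈⟨ *-assoc ((- 1ˢ) ^ᴿ n) ((- 1ˢ) ^ᴿ n) X ⟨
      (- 1ˢ) ^ᴿ n * (- 1ˢ) ^ᴿ n * X
        -- The sign in front meets the one left by reversing 2n columns.
        ≈⟨ trans (*-congʳ {x = X} (-1^-square n)) (*-identityˡ X) ⟩
      X
        ≈⟨ ∑-partitions (n ℕ.* 2) ⟩
      ∑ (partitions (n ℕ.* 2) D) (λ p → ∏ (allFin M) (schur (proj₁ p))) ∎
      where
      X : Series M
      X = ∑ (shapes (n ℕ.* 2) D) (λ xs → ∏ (allFin M) λ s → H.schurᴿ s xs)

      index : Fin n → Vec (Vec (Fin (n ℕ.* 2)) (n ℕ.* 2)) M → Vec (Fin (n ℕ.* 2)) (M ℕ.* 2)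
      index i σs = Vec.concat (Vec.map (λ σ → lookup σ (odd i) ∷ lookup σ (even i) ∷ []) σs)

      lookup-odd : ∀ i σs s → lookup (index i σs) (odd s) ≡ lookup (lookup σs s) (odd i)
      lookup-odd i σs s = ≡.trans (Vec.lookup-concat (Vec.map _ σs) s 0F)
        (cong (λ v → lookup v 0F) (Vec.lookup-map s _ σs))

      lookup-even : ∀ i σs s → lookup (index i σs) (even s) ≡ lookup (lookup σs s) (even i)
      lookup-even i σs s = ≡.trans (Vec.lookup-concat (Vec.map _ σs) s 1F)
        (cong (λ v → lookup v 1F) (Vec.lookup-map s _ σs))

      minors-term : ∀ i σs → ∑ (indices (n ℕ.* 2 ℕ.+ D)) (termPf M n (index i σs)) ≈
        ∑ (pairs (down (n ℕ.* 2 ℕ.+ D))) λ p → ∏ (allFin M) λ s →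
          minor (H.entry s) p (lookup (lookup σs s) (odd i)) (lookup (lookup σs s) (even i))
      minors-term i σs = begin
        ∑ (indices K) (termPf M n (index i σs))
          ≈⟨ Sum.fold-cong (indices K) (λ (k , l) → Prod.fold-cong (allFin M) λ s → trans
               (det₂ _ _ _ _)
               (reflexive (cong₂ (minor (H.entry s) (columns (k , l))) (lookup-odd i σs s) (lookup-even i σs s)))) ⟩
        ∑ (indices K) (G ∘ columns)
          ≡⟨ Sum.fold-map columns (indices K) G ⟨
        ∑ (List.map columns (indices K)) G
          ≡⟨ cong (λ ps → ∑ ps G) (columns-indices K) ⟩
        ∑ (pairs (down K)) G ∎
        where
        K : ℕ
        K = n ℕ.* 2 ℕ.+ D
        G : ℕ × ℕ → Series M
        G p = ∏ (allFin M) λ s →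
          minor (H.entry s) p (lookup (lookup σs s) (odd i)) (lookup (lookup σs s) (even i))

      expanded : ∑ (words M (𝔈 n)) (λ σs → sgns σs • ∏ (allFin n) λ i → b (index i σs)) ≈
        n ! · ((- 1ˢ) ^ᴿ n * X)
      expanded = trans
        (Sum.fold-cong (words M (𝔈 n)) λ σs → trans (sgns-• σs _)
          (*-congˡ {x = ∏ (allFin M) (λ s → sgnᴿ (lookup σs s))} (Prod.fold-cong (allFin n) λ i →
            trans (b≈ (index i σs)) (minors-term i σs))))
        (pf-expansion odd-M n D)

open import Data.Fin.Base using (Fin)
open import Data.List.Base using (allFin)
open import Data.Nat.Base using (ℕ; NonZero; _*_)
open import Data.Product.Base using (Σ-syntax; _×_; _,_; proj₁)
open import Data.Rational.Base using (1ℚ; -_)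
open import Data.Vec.Base using (Vec)

-- Convergence of the array entries

module Terms {M : ℕ} (s₀ : Fin M) (D : ℕ) where
  open Truncated M D using (ring; halve)
  open CommutativeRing ring using (_≈_; refl; trans; reflexive; zeroˡ; zeroʳ; +-cong; +-identityˡ; +-congʳ; *-congʳ)
  open Alternating (Truncated.ring M D) halve using (module Sum; ∏-zero)
  open Identities {M} D using (entry-large; det₂; •-cong)
  open import Algebra.Properties.Ring (CommutativeRing.ring (Truncated.ring M D)) using (-0#≈0#)

  det-term : ∀ {n} → Vec (Fin n) M → ℕ → Series M
  det-term i k = ∏ (allFin M) λ s → h s (+ k ℤ.- pos (lookup i s))

  det-term-zero : ∀ {n} (i : Vec (Fin n) M) → det-term i 0 ≈ 0ˢ
  det-term-zero i = ∏-zero s₀ (λ s → h s (+ 0 ℤ.- pos (lookup i s))) refl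

  det-term-large : ∀ {n} (i : Vec (Fin n) M) {k} → n ℕ.+ D ℕ.< k → det-term i k ≈ 0ˢ
  det-term-large i {k} n+D<k =
    ∏-zero s₀ (λ s → h s (+ k ℤ.- pos (lookup i s))) (entry-large s₀ n+D<k (lookup i s₀))

  det-term-stable : ∀ {n} (i : Vec (Fin n) M) →
    ∑ (down (n ℕ.+ suc D)) (det-term i) ≈ ∑ (down (n ℕ.+ D)) (det-term i)
  det-term-stable {n} i = trans (reflexive (cong (λ N → ∑ (down N) (det-term i)) (ℕ.+-suc n D)))
    (trans (+-congʳ {x = ∑ (down (n ℕ.+ D)) (det-term i)} (det-term-large i (ℕ.n<1+n _))) (+-identityˡ _))

  det-term-complete : ∀ {n} (i : Vec (Fin n) M) k → ¬ det-term i k ≈ 0ˢ → k ∈ down (n ℕ.+ D)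
  det-term-complete i zero    ≉0 = contradiction (det-term-zero i) ≉0
  det-term-complete {n} i (suc k) ≉0 with suc k ℕ.≤? n ℕ.+ D
  ... | yes k≤ = ∈-down k≤
  ... | no  k≰ = contradiction (det-term-large i (ℕ.≰⇒> k≰)) ≉0

  det₂-zero : ∀ {a b c d} → a Defs.* d ≈ 0ˢ → c Defs.* b ≈ 0ˢ → det (matrix₂ a b c d) ≈ 0ˢ
  det₂-zero {a} {b} {c} {d} ad cb = trans (det₂ a b c d)
    (trans (+-cong ad (trans (•-cong (- 1ℚ) cb) -0#≈0#)) (+-identityˡ 0ˢ))

  -- For l = 0 the second column of each 2×2 determinant has only negative subscripts.
  pf-term-zero : ∀ n i k → termPf M n i (k , 0) ≈ 0ˢ
  pf-term-zero n i k = ∏-zero s₀ _ (det₂-zero (zeroʳ _) (zeroʳ _))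

  -- Here the first column vanishes modulo degree above `D`. A bound on k + l + 1 bounds `k` and `l`
  -- at once, which makes the double sum finite.
  pf-term-large : ∀ n i k l → n * 2 ℕ.+ D ℕ.< k ℕ.+ l ℕ.+ 1 → termPf M n i (k , l) ≈ 0ˢ
  pf-term-large n i k l large = ∏-zero s₀ _ (det₂-zero
    (trans (*-congʳ {x = h s₀ (+ l ℤ.- i₂)} (entry-large s₀ large (lookup i (odd s₀)))) (zeroˡ _))
    (trans (*-congʳ {x = h s₀ (+ l ℤ.- i₁)} (entry-large s₀ large (lookup i (even s₀)))) (zeroˡ _)))
    where
    i₁ i₂ : ℤ
    i₁ = pos (lookup i (odd s₀))
    i₂ = pos (lookup i (even s₀))

  -- The indices gained are the (k , l) with l ≥ 1 and k + l = N.
  ∑-indices-suc : ∀ N (f : ℕ × ℕ → Series M) → (∀ k l → N ℕ.< k ℕ.+ l ℕ.+ 1 → f (k , l) ≈ 0ˢ) →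
    ∑ (indices (suc N)) f ≈ ∑ (indices N) f
  ∑-indices-suc N f f≈0 = trans (reflexive (Sum.fold-map differences (pairs (down (suc N))) f))
    (trans (Sum.fold-++ (List.map (suc N ,_) (down N)) (pairs (down N)) (f ∘ differences))
    (trans (+-congʳ {x = ∑ (pairs (down N)) (f ∘ differences)} (trans
       (reflexive (Sum.fold-map (suc N ,_) (down N) (f ∘ differences)))
       (Sum.fold-ε (down N) λ l → f≈0 (N ℕ.∸ l) l (large l))))
    (trans (+-identityˡ _) (reflexive (≡.sym (Sum.fold-map differences (pairs (down N)) f))))))
    where
    large : ∀ l → N ℕ.< N ℕ.∸ l ℕ.+ l ℕ.+ 1
    large l = subst (N ℕ.<_) (ℕ.+-comm 1 (N ℕ.∸ l ℕ.+ l))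
      (ℕ.s≤s (subst (N ℕ.≤_) (ℕ.+-comm l (N ℕ.∸ l)) (ℕ.m≤n+m∸n N l)))

  pf-term-stable : ∀ n i →
    ∑ (indices (n * 2 ℕ.+ suc D)) (termPf M n i) ≈ ∑ (indices (n * 2 ℕ.+ D)) (termPf M n i)
  pf-term-stable n i = trans
    (reflexive (cong (λ N → ∑ (indices N) (termPf M n i)) (ℕ.+-suc (n * 2) D)))
    (∑-indices-suc (n * 2 ℕ.+ D) (termPf M n i) (pf-term-large n i))

  pf-term-complete : ∀ n i kl → ¬ termPf M n i kl ≈ 0ˢ → kl ∈ indices (n * 2 ℕ.+ D)
  pf-term-complete n i (k , zero)  ≉0 = contradiction (pf-term-zero n i k) ≉0
  pf-term-complete n i (k , suc l) ≉0 with k ℕ.+ suc l ℕ.+ 1 ℕ.≤? n * 2 ℕ.+ D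
  ... | yes ≤N = ∈-indices ≤N
  ... | no  ≰N = contradiction (pf-term-large n i k (suc l) (ℕ.≰⇒> ≰N)) ≉0

-- From all truncations to formal sums

hasSum-partitions : ∀ {M} (s₀ : Fin M) n {S : Series M} →
  (∀ D → Truncated._≈_ M D S (∑ (partitions n D) (λ p → ∏ (allFin M) (schur (proj₁ p))))) →
  HasSum {I = Partition≤ n} (λ p → ∏ (allFin M) (schur (proj₁ p))) S
hasSum-partitions {M} s₀ n S≈ μ = partitions n D , partitions-unique n D , complete ,
  ≡.trans (Truncated.at (S≈ D) μ ℕ.≤-refl) (coeff-∑ (partitions n D) _ μ)
  where
  D : ℕ
  D = total μ
  complete : ∀ p → coeff (∏ (allFin M) (schur (proj₁ p))) μ ≢ ℚ.0ℚ → p ∈ partitions n D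
  -- The vanishing of large Schur functions only refutes unboundedness; the bound on the parts is
  -- decidable, so it follows.
  complete p ≢0 = partitions-complete n D (decidable-stable (Linked.linked? (λ x y → y ℕ.≤? x) (D ∷ partsOf p))
    λ ¬bounded → ≢0 (Truncated.at (Identities.Sums.schur-large D s₀ (proj₁ p) ¬bounded) μ ℕ.≤-refl))

detArray : ∀ m n → Vec (Fin n) (2 * m) → Series (2 * m)
detArray m n i = diagonal λ d → ∑ (down (n ℕ.+ d)) (termDet m n i)

pfArray : ∀ m n → Vec (Fin (n * 2)) (m * 2) → Series m
pfArray m n i = diagonal λ d → ∑ (indices (n * 2 ℕ.+ d)) (termPf m n i)

hasSum-Det : ∀ m n → Fin (2 * m) →
  HasSum {I = Partition≤ n} (λ p → ∏ (allFin (2 * m)) (schur (proj₁ p))) (Det m n (detArray m n))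
hasSum-Det m n s₀ = hasSum-partitions s₀ n λ D →
  Identities.Sums.hyperdeterminant D s₀ (even-power (Truncated.ring (2 * m) D) m) n (detArray m n)
    (λ i → diagonal-≈ (λ d → ∑ (down (n ℕ.+ d)) (termDet m n i)) (λ d → Terms.det-term-stable s₀ d i) D)

hasSum-Pf : ∀ m n → Fin m → 2 ∤ m →
  HasSum {I = Partition≤ (n * 2)} (λ p → ∏ (allFin m) (schur (proj₁ p)))
    (((- 1ℚ) ^ n) • Pf m n (pfArray m n))
hasSum-Pf m n s₀ 2∤m = hasSum-partitions s₀ (n * 2) λ D →
  Identities.Sums.hyperpfaffian D s₀ (odd-power (Truncated.ring m D) m 2∤m) n (pfArray m n)
    (λ i → diagonal-≈ (λ d → ∑ (indices (n * 2 ℕ.+ d)) (termPf m n i))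
      (λ d → Terms.pf-term-stable s₀ d n i) D)

theorem3p4 : (n : ℕ) .{{_ : NonZero n}} →
    ((m : ℕ) .{{_ : NonZero m}} →
    Σ[ A ∈ (Vec (Fin n) (2 * m) → Series (2 * m)) ]
    ((∀ i → HasSum (termDet m n i) (A i)) ×
    HasSum {I = Partition≤ n} (λ p → ∏ (allFin (2 * m)) (schur (proj₁ p))) (Det m n A))) ×
    ((m : ℕ) → 2 ∤ m →
    Σ[ B ∈ (Vec (Fin (n * 2)) (m * 2) → Series m) ]
    ((∀ i → HasSum (termPf m n i) (B i)) ×
    HasSum {I = Partition≤ (n * 2)} (λ p → ∏ (allFin m) (schur (proj₁ p))) (((- 1ℚ) ^ n) • Pf m n B)))
theorem3p4 n =
  (λ { m@(suc _) → detArray m n ,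
    (λ i → hasSum-diagonal _ _ (λ d → down-unique (n ℕ.+ d))
      (λ d → Terms.det-term-complete Fin.zero d i)) ,
    hasSum-Det m n Fin.zero }) ,
  -- Zero is even, so an odd `m` always provides the alphabet `Fin.zero`.
  (λ { zero 2∤m → contradiction (2 ∣0) 2∤m
     ; m@(suc _) 2∤m → pfArray m n ,
    (λ i → hasSum-diagonal _ _ (λ d → indices-unique (n * 2 ℕ.+ d))
      (λ d → Terms.pf-term-complete Fin.zero d n i)) ,
    hasSum-Pf m n Fin.zero 2∤m })
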